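{- Let $W\subset S^1$ with $|W|=4$ satisfy condition $T'(W)$: $(W+\tfrac ik)\cap W=\emptyset$ for $k\in\{4,5\}$ and all $i$ with $1\le i\le k-1$, $\gcd(i,k)=1$. Then $P(W)$ holds.
   Context: Identify $S^1$ with $\mathbb{R}/\mathbb{Z}$. The group $O(2)$ acts on $S^1$ by translations $\sigma_a(x)=x+a$ and reflections $\tau_a(x)=-x+2a$. A coloring $c:S^1\to\{R,B\}$ is distinguishing if no non-identity $\gamma\in O(2)$ satisfies $c\circ\gamma=c$. For $W\subset S^1$ with trivial pointwise stabilizer in $O(2)$, $P(W)$ holds if every precoloring $c:S^1\setminus W\to\{R,B\}$ extends to a distinguishing coloring of $S^1$. -}

module Defs where

open import Algebra.Bundles using (AbelianGroup)
open import Data.Fin.Base using (Fin)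
open import Data.Integer.Base as ℤ using (ℤ; +_)
open import Data.Nat.Base as ℕ using (ℕ; NonZero)
open import Data.Nat.GCD using (gcd)
import Data.Integer.Properties as ℤ
import Data.Nat.Properties as ℕ
open import Data.Product.Base using (∃; ∃-syntax; _×_; _,_; proj₁)
open import Data.Rational.Base as ℚ using (ℚ; 0ℚ; ½; ∣_∣; _/_)
import Data.Rational.Properties as ℚ
import Data.Rational.Unnormalised.Properties as ℚᵘ
open import Data.Rational.Literals using (fromℤ)
import Data.Rational.Unnormalised.Base as ℚᵘ
open import Data.Rational.Solver using (module +-*-Solver)
open import Data.Sum.Base using (_⊎_)
open import Function.Bundles using (Func; Bijection; _⟨$⟩_)
open import Level using (0ℓ)
open import Relation.Binary.Bundles using (Setoid)
import Relation.Binary.Construct.On as On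
open import Relation.Binary.PropositionalEquality
  using (_≡_; refl; sym; trans; cong; cong₂; subst; setoid)
open import Relation.Nullary using (¬_)
open import Relation.Unary using (Pred; ∁; _∩_; Empty)

open +-*-Solver using (solve; _:=_; _:+_; _:-_; :-_)

-- The real numbers: Cauchy sequences of rationals modulo null sequences.

Null : (ℕ → ℚ) → Set
Null s = ∀ ε → 0ℚ ℚ.< ε → ∃[ N ] ∀ n → N ℕ.≤ n → ∣ s n ∣ ℚ.< ε

Cauchy : (ℕ → ℚ) → Set
Cauchy s = ∀ ε → 0ℚ ℚ.< ε →
  ∃[ N ] ∀ m n → N ℕ.≤ m → N ℕ.≤ n → ∣ s m ℚ.- s n ∣ ℚ.< ε

record ℝ : Set where
  constructor mkℝ
  field
    seq    : ℕ → ℚ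
    cauchy : Cauchy seq

open ℝ public

infix 4 _≈ᴿ_
infixl 6 _+ᴿ_
infix 8 -ᴿ_

_≈ᴿ_ : ℝ → ℝ → Set
x ≈ᴿ y = Null (λ n → seq x n ℚ.- seq y n)

private
  half-pos : ∀ {ε} → 0ℚ ℚ.< ε → 0ℚ ℚ.< ½ ℚ.* ε
  half-pos {ε} 0<ε = subst (ℚ._< ½ ℚ.* ε) (ℚ.*-zeroʳ ½) (ℚ.*-monoʳ-<-pos ½ 0<ε)

  half+half : ∀ ε → ½ ℚ.* ε ℚ.+ ½ ℚ.* ε ≡ ε
  half+half ε = trans (sym (ℚ.*-distribʳ-+ ε ½ ½)) (ℚ.*-identityˡ ε)

  ∣+∣<ε : ∀ {p q ε} → ∣ p ∣ ℚ.< ½ ℚ.* ε → ∣ q ∣ ℚ.< ½ ℚ.* ε → ∣ p ℚ.+ q ∣ ℚ.< ε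
  ∣+∣<ε {p} {q} {ε} p< q< = ℚ.≤-<-trans (ℚ.∣p+q∣≤∣p∣+∣q∣ p q)
    (subst (∣ p ∣ ℚ.+ ∣ q ∣ ℚ.<_) (half+half ε) (ℚ.+-mono-< p< q<))

  interchange : ∀ p q r s → (p ℚ.- r) ℚ.+ (q ℚ.- s) ≡ (p ℚ.+ q) ℚ.- (r ℚ.+ s)
  interchange = solve 4 (λ p q r s → (p :- r) :+ (q :- s) := (p :+ q) :- (r :+ s)) refl

  neg-minus : ∀ p q → ℚ.- (p ℚ.- q) ≡ (ℚ.- p) ℚ.- (ℚ.- q)
  neg-minus = solve 2 (λ p q → :- (p :- q) := (:- p) :- (:- q)) refl

  swap-minus : ∀ p q → ℚ.- (p ℚ.- q) ≡ q ℚ.- p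
  swap-minus = solve 2 (λ p q → :- (p :- q) := q :- p) refl

  telescope : ∀ p q r → (p ℚ.- q) ℚ.+ (q ℚ.- r) ≡ p ℚ.- r
  telescope = solve 3 (λ p q r → (p :- q) :+ (q :- r) := p :- r) refl

  Null-cong : ∀ {s t} → (∀ n → s n ≡ t n) → Null s → Null t
  Null-cong s≗t s→0 ε 0<ε with s→0 ε 0<ε
  ... | N , s< = N , λ n N≤n → subst (λ q → ∣ q ∣ ℚ.< ε) (s≗t n) (s< n N≤n)

  Null-+ : ∀ {s t} → Null s → Null t → Null (λ n → s n ℚ.+ t n)
  Null-+ {s} {t} s→0 t→0 ε 0<ε with s→0 _ (half-pos 0<ε) | t→0 _ (half-pos 0<ε)
  ... | M , s< | N , t< = M ℕ.⊔ N , λ n n≥ →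
    ∣+∣<ε {s n} {t n} (s< n (ℕ.≤-trans (ℕ.m≤m⊔n M N) n≥))
                      (t< n (ℕ.≤-trans (ℕ.m≤n⊔m M N) n≥))

  Null-neg : ∀ {s} → Null s → Null (λ n → ℚ.- s n)
  Null-neg {s} s→0 ε 0<ε with s→0 ε 0<ε
  ... | N , s< = N , λ n N≤n → subst (ℚ._< ε) (sym (ℚ.∣-p∣≡∣p∣ (s n))) (s< n N≤n)

≗⇒≈ᴿ : ∀ {x y} → (∀ n → seq x n ≡ seq y n) → x ≈ᴿ y
≗⇒≈ᴿ {x} {y} x≗y ε 0<ε = 0 , λ n _ →
  subst (λ q → ∣ q ∣ ℚ.< ε)
        (sym (trans (cong (ℚ._- seq y n) (x≗y n)) (ℚ.+-inverseʳ (seq y n))))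
        0<ε

≈ᴿ-sym : ∀ {x y} → x ≈ᴿ y → y ≈ᴿ x
≈ᴿ-sym {x} {y} x≈y = Null-cong (λ n → swap-minus (seq x n) (seq y n)) (Null-neg x≈y)

≈ᴿ-trans : ∀ {x y z} → x ≈ᴿ y → y ≈ᴿ z → x ≈ᴿ z
≈ᴿ-trans {x} {y} {z} x≈y y≈z =
  Null-cong (λ n → telescope (seq x n) (seq y n) (seq z n)) (Null-+ x≈y y≈z)

fromℚ : ℚ → ℝ
fromℚ q = mkℝ (λ _ → q) λ ε 0<ε → 0 , λ _ _ _ _ →
  subst (λ p → ∣ p ∣ ℚ.< ε) (sym (ℚ.+-inverseʳ q)) 0<ε

_+ᴿ_ : ℝ → ℝ → ℝ
seq (x +ᴿ y) n = seq x n ℚ.+ seq y n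
cauchy (x +ᴿ y) ε 0<ε with cauchy x _ (half-pos 0<ε) | cauchy y _ (half-pos 0<ε)
... | M , x< | N , y< = M ℕ.⊔ N , λ m n m≥ n≥ →
  subst (λ q → ∣ q ∣ ℚ.< ε)
    (interchange (seq x m) (seq y m) (seq x n) (seq y n))
    (∣+∣<ε {seq x m ℚ.- seq x n} {seq y m ℚ.- seq y n}
      (x< m n (ℕ.≤-trans (ℕ.m≤m⊔n M N) m≥) (ℕ.≤-trans (ℕ.m≤m⊔n M N) n≥))
      (y< m n (ℕ.≤-trans (ℕ.m≤n⊔m M N) m≥) (ℕ.≤-trans (ℕ.m≤n⊔m M N) n≥)))

-ᴿ_ : ℝ → ℝ
seq (-ᴿ x) n = ℚ.- seq x n
cauchy (-ᴿ x) ε 0<ε with cauchy x ε 0<ε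
... | N , x< = N , λ m n m≥ n≥ →
  subst (ℚ._< ε)
    (trans (sym (ℚ.∣-p∣≡∣p∣ (seq x m ℚ.- seq x n)))
           (cong ∣_∣ (neg-minus (seq x m) (seq x n))))
    (x< m n m≥ n≥)

+ᴿ-cong : ∀ {x y u v} → x ≈ᴿ y → u ≈ᴿ v → x +ᴿ u ≈ᴿ y +ᴿ v
+ᴿ-cong {x} {y} {u} {v} x≈y u≈v =
  Null-cong (λ n → interchange (seq x n) (seq u n) (seq y n) (seq v n)) (Null-+ x≈y u≈v)

-ᴿ-cong : ∀ {x y} → x ≈ᴿ y → -ᴿ x ≈ᴿ -ᴿ y
-ᴿ-cong {x} {y} x≈y = Null-cong (λ n → neg-minus (seq x n) (seq y n)) (Null-neg x≈y)

ℝ-abelianGroup : AbelianGroup 0ℓ 0ℓ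
ℝ-abelianGroup = record
  { Carrier = ℝ
  ; _≈_     = _≈ᴿ_
  ; _∙_     = _+ᴿ_
  ; ε       = fromℚ 0ℚ
  ; _⁻¹     = -ᴿ_
  ; isAbelianGroup = record
    { isGroup = record
      { isMonoid = record
        { isSemigroup = record
          { isMagma = record
            { isEquivalence = record
              { refl  = λ {x} → ≗⇒≈ᴿ {x} {x} (λ _ → refl)
              ; sym   = λ {x} {y} → ≈ᴿ-sym {x} {y}
              ; trans = λ {x} {y} {z} → ≈ᴿ-trans {x} {y} {z}
              }
            ; ∙-cong = λ {x} {y} {u} {v} → +ᴿ-cong {x} {y} {u} {v}
            }
          ; assoc = λ x y z → ≗⇒≈ᴿ {(x +ᴿ y) +ᴿ z} {x +ᴿ (y +ᴿ z)}
                                λ n → ℚ.+-assoc (seq x n) (seq y n) (seq z n)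
          }
        ; identity = (λ x → ≗⇒≈ᴿ {fromℚ 0ℚ +ᴿ x} {x} λ n → ℚ.+-identityˡ (seq x n))
                   , (λ x → ≗⇒≈ᴿ {x +ᴿ fromℚ 0ℚ} {x} λ n → ℚ.+-identityʳ (seq x n))
        }
      ; inverse = (λ x → ≗⇒≈ᴿ {(-ᴿ x) +ᴿ x} {fromℚ 0ℚ} λ n → ℚ.+-inverseˡ (seq x n))
                , (λ x → ≗⇒≈ᴿ {x +ᴿ (-ᴿ x)} {fromℚ 0ℚ} λ n → ℚ.+-inverseʳ (seq x n))
      ; ⁻¹-cong = λ {x} {y} → -ᴿ-cong {x} {y}
      }
    ; comm = λ x y → ≗⇒≈ᴿ {x +ᴿ y} {y +ᴿ x} λ n → ℚ.+-comm (seq x n) (seq y n)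
    }
  }

-- The circle ℝ/ℤ, as the reals with a coarser equality.

ℤ→ℝ : ℤ → ℝ
ℤ→ℝ n = fromℚ (fromℤ n)

infix 4 _≈_
infixl 6 _+_
infix 8 -_

_≈_ : ℝ → ℝ → Set
x ≈ y = ∃[ n ] x +ᴿ (-ᴿ y) ≈ᴿ ℤ→ℝ n

_+_ : ℝ → ℝ → ℝ
_+_ = _+ᴿ_

-_ : ℝ → ℝ
-_ = -ᴿ_

fromℤ-+ : ∀ m n → fromℤ m ℚ.+ fromℤ n ≡ fromℤ (m ℤ.+ n)
fromℤ-+ m n = ℚ.toℚᵘ-injective (ℚᵘ.≃-trans (ℚ.toℚᵘ-homo-+ (fromℤ m) (fromℤ n))
  (ℚᵘ.*≡* (cong (ℤ._* + 1) (cong₂ ℤ._+_ (ℤ.*-identityʳ m) (ℤ.*-identityʳ n)))))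

fromℤ-neg : ∀ n → ℚ.- fromℤ n ≡ fromℤ (ℤ.- n)
fromℤ-neg n = ℚ.toℚᵘ-injective (ℚᵘ.≃-trans (ℚ.toℚᵘ-homo‿- (fromℤ n)) (ℚᵘ.*≡* refl))

≈ᴿ⇒≈ : ∀ {x y} → x ≈ᴿ y → x ≈ y
≈ᴿ⇒≈ {x} {y} x≈y = + 0 , Null-cong
  (λ n → sym (ℚ.+-identityʳ (seq x n ℚ.- seq y n))) x≈y

private
  Null-+-ℤ : ∀ (s t u : ℕ → ℚ) k l → (∀ n → s n ℚ.+ t n ≡ u n) →
    Null (λ n → s n ℚ.- fromℤ k) → Null (λ n → t n ℚ.- fromℤ l) →
    Null (λ n → u n ℚ.- fromℤ (k ℤ.+ l))
  Null-+-ℤ s t u k l s+t≗u s→k t→l = Null-cong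
    {λ n → (s n ℚ.- fromℤ k) ℚ.+ (t n ℚ.- fromℤ l)}
    (λ n → trans (interchange (s n) (t n) (fromℤ k) (fromℤ l))
                 (cong₂ ℚ._-_ {s n ℚ.+ t n} {u n} {fromℤ k ℚ.+ fromℤ l} {fromℤ (k ℤ.+ l)}
                   (s+t≗u n) (fromℤ-+ k l)))
    (Null-+ {λ n → s n ℚ.- fromℤ k} {λ n → t n ℚ.- fromℤ l} s→k t→l)

  Null-neg-ℤ : ∀ (s t : ℕ → ℚ) k → (∀ n → ℚ.- s n ≡ t n) →
    Null (λ n → s n ℚ.- fromℤ k) → Null (λ n → t n ℚ.- fromℤ (ℤ.- k))
  Null-neg-ℤ s t k -s≗t s→k = Null-cong
    {λ n → ℚ.- (s n ℚ.- fromℤ k)}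
    (λ n → trans (neg-minus (s n) (fromℤ k))
                 (cong₂ ℚ._-_ {ℚ.- s n} {t n} {ℚ.- fromℤ k} {fromℤ (ℤ.- k)}
                   (-s≗t n) (fromℤ-neg k)))
    (Null-neg {λ n → s n ℚ.- fromℤ k} s→k)

≈-sym : ∀ {x y} → x ≈ y → y ≈ x
≈-sym {x} {y} (k , x≈y) =
  ℤ.- k , Null-neg-ℤ (seq (x +ᴿ (-ᴿ y))) (seq (y +ᴿ (-ᴿ x))) k
    (λ n → swap-minus (seq x n) (seq y n)) x≈y

≈-trans : ∀ {x y z} → x ≈ y → y ≈ z → x ≈ z
≈-trans {x} {y} {z} (k , x≈y) (l , y≈z) =
  k ℤ.+ l , Null-+-ℤ (seq (x +ᴿ (-ᴿ y))) (seq (y +ᴿ (-ᴿ z))) (seq (x +ᴿ (-ᴿ z))) k l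
    (λ n → telescope (seq x n) (seq y n) (seq z n)) x≈y y≈z

+-cong : ∀ {x y u v} → x ≈ y → u ≈ v → x + u ≈ y + v
+-cong {x} {y} {u} {v} (k , x≈y) (l , u≈v) =
  k ℤ.+ l ,
  Null-+-ℤ (seq (x +ᴿ (-ᴿ y))) (seq (u +ᴿ (-ᴿ v))) (seq ((x + u) +ᴿ (-ᴿ (y + v)))) k l
    (λ n → interchange (seq x n) (seq u n) (seq y n) (seq v n)) x≈y u≈v

-‿cong : ∀ {x y} → x ≈ y → - x ≈ - y
-‿cong {x} {y} (k , x≈y) =
  ℤ.- k , Null-neg-ℤ (seq (x +ᴿ (-ᴿ y))) (seq ((- x) +ᴿ (-ᴿ (- y)))) k
    (λ n → neg-minus (seq x n) (seq y n)) x≈y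

S¹-abelianGroup : AbelianGroup 0ℓ 0ℓ
S¹-abelianGroup = record
  { Carrier = ℝ
  ; _≈_     = _≈_
  ; _∙_     = _+_
  ; ε       = fromℚ 0ℚ
  ; _⁻¹     = -_
  ; isAbelianGroup = record
    { isGroup = record
      { isMonoid = record
        { isSemigroup = record
          { isMagma = record
            { isEquivalence = record
              { refl  = λ {x} → ≈ᴿ⇒≈ {x} {x} (R.refl {x})
              ; sym   = λ {x} {y} → ≈-sym {x} {y}
              ; trans = λ {x} {y} {z} → ≈-trans {x} {y} {z}
              }
            ; ∙-cong = λ {x} {y} {u} {v} → +-cong {x} {y} {u} {v}
            }
          ; assoc = λ x y z → ≈ᴿ⇒≈ {(x + y) + z} {x + (y + z)} (R.assoc x y z)
          }
        ; identity = (λ x → ≈ᴿ⇒≈ {fromℚ 0ℚ + x} {x} (R.identityˡ x))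
                   , (λ x → ≈ᴿ⇒≈ {x + fromℚ 0ℚ} {x} (R.identityʳ x))
        }
      ; inverse = (λ x → ≈ᴿ⇒≈ {(- x) + x} {fromℚ 0ℚ} (R.inverseˡ x))
                , (λ x → ≈ᴿ⇒≈ {x + (- x)} {fromℚ 0ℚ} (R.inverseʳ x))
      ; ⁻¹-cong = λ {x} {y} → -‿cong {x} {y}
      }
    ; comm = λ x y → ≈ᴿ⇒≈ {x + y} {y + x} (R.comm x y)
    }
  }
  where module R = AbelianGroup ℝ-abelianGroup

S¹-setoid : Setoid 0ℓ 0ℓ
S¹-setoid = AbelianGroup.setoid S¹-abelianGroup

S¹ : Set
S¹ = Setoid.Carrier S¹-setoid

data O2 : Set where
  σ : S¹ → O2
  τ : S¹ → O2

infixr 5 _·_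

_·_ : O2 → S¹ → S¹
σ a · x = x + a
τ a · x = (- x) + (a + a)

-- The representation is redundant (τ a and τ (a + 1/2) are the same reflection),
-- so elements are compared by their action, which is faithful.
IsIdentity : O2 → Set
IsIdentity γ = ∀ x → γ · x ≈ x

data Color : Set where
  R B : Color

subset-setoid : Pred S¹ 0ℓ → Setoid 0ℓ 0ℓ
subset-setoid W = On.setoid {B = ∃ W} S¹-setoid proj₁

HasCardinality : Pred S¹ 0ℓ → ℕ → Set
HasCardinality W n = Bijection (setoid (Fin n)) (subset-setoid W)

Coloring : Set
Coloring = Func S¹-setoid (setoid Color)

Precoloring : Pred S¹ 0ℓ → Set
Precoloring W = Func (subset-setoid (∁ W)) (setoid Color)

Distinguishing : Coloring → Set
Distinguishing c = ¬ (∃[ γ ] (¬ IsIdentity γ) × (∀ x → c ⟨$⟩ (γ · x) ≡ c ⟨$⟩ x))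

Extends : (W : Pred S¹ 0ℓ) → Coloring → Precoloring W → Set
Extends W d c = ∀ (p : ∃ (∁ W)) → d ⟨$⟩ proj₁ p ≡ c ⟨$⟩ p

-- No triviality of the pointwise stabilizer of W is demanded here: it follows
-- from P W. A non-identity γ fixing W pointwise preserves every coloring that
-- is constant off W, so no extension of a constant precoloring is distinguishing.
P : Pred S¹ 0ℓ → Set
P W = ∀ (c : Precoloring W) → ∃[ d ] Extends W d c × Distinguishing d

_⊕_ : Pred S¹ 0ℓ → S¹ → Pred S¹ 0ℓ
(W ⊕ a) y = ∃[ x ] W x × y ≈ x + a

T′ : Pred S¹ 0ℓ → Set
T′ W = ∀ k .{{_ : NonZero k}} → k ≡ 4 ⊎ k ≡ 5 →
       ∀ i → 1 ℕ.≤ i → i ℕ.≤ k ℕ.∸ 1 → gcd i k ≡ 1 →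
       Empty ((W ⊕ fromℚ (+ i / k)) ∩ W)

-- Suppose that every coloring extending the given one has a non-identity symmetry. If f has the
-- reflection t ↦ s − t and f with x flipped has t ↦ u − t, then f differs from its translate by
-- s − u exactly at x and u − x; comparing two such differences, or a difference with a rotation
-- of f, gives sets of a few points in which every point must occur an even number of times.
--
-- If some f has a rotation, it is symmetric about each point of W and invariant under the
-- differences of W, so W itself and each triangle in W are symmetric; this forces two points of W
-- to differ by an element of order 4 or 5. Otherwise each f has a single axis. Let x, y in W lie
-- off the axis of f. The axes of f with x or y flipped then agree, or are mirror images in the axis
-- of f, or f is one point away from a coloring with rotations, which is excluded as before. It
-- follows that at most two points of W lie off the axis of f, hence two lie on it, and no more than
-- two as ℝ/ℤ has only one element of order 2. Flipping a third point moves the axis away from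
-- three points.

{-# OPTIONS --safe #-}

module Submission where

open import Algebra.Bundles using (AbelianGroup)
import Algebra.Properties.AbelianGroup as AbelianGroupProperties
import Algebra.Solver.CommutativeMonoid as CommutativeMonoidSolver
import Algebra.Solver.CommutativeMonoid.Normal as CommutativeMonoidNormal
open import Axiom.ExcludedMiddle using (ExcludedMiddle)
open import Data.Bool.Base using (Bool; true; false; _xor_)
open import Data.Bool.Properties using (xor-comm; xor-assoc; xor-same; xor-identityʳ)
open import Data.Empty using (⊥; ⊥-elim)
open import Data.Fin.Base using (Fin; zero; suc)
open import Data.Fin.Patterns
open import Data.Integer.Base as ℤ using (ℤ; +_)
import Data.Integer.DivMod as ℤ
import Data.Integer.Properties as ℤ
open import Data.List.Base using (List; []; _∷_; _++_; map; lookup; removeAt)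
open import Data.List.Relation.Unary.All using (All; []; _∷_)
open import Data.List.Relation.Unary.Any using (Any; here; there)
open import Data.Nat.Base as ℕ using (ℕ; NonZero)
import Data.Nat.Properties as ℕ
open import Data.Product.Base using (∃; ∃-syntax; _×_; _,_; proj₁; proj₂)
open import Data.Rational.Base as ℚ using (ℚ; 0ℚ; 1ℚ; ½; ∣_∣; _/_)
open import Data.Rational.Literals using (fromℤ)
import Data.Rational.Properties as ℚ
open import Data.Rational.Solver using (module +-*-Solver)
import Data.Rational.Unnormalised.Base as ℚᵘ
import Data.Rational.Unnormalised.Properties as ℚᵘ
open import Data.Sum.Base as Sum using (_⊎_; inj₁; inj₂)
open import Data.Vec.Base as Vec using (Vec; []; _∷_)
open import Function.Base using (case_of_)
open import Function.Bundles using (Func; Bijection; _⟨$⟩_)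
open import Level using (Level; 0ℓ)
open import Relation.Binary.Definitions using (Decidable; _Respects_)
open import Relation.Binary.PropositionalEquality as ≡ using (_≡_; module ≡-Reasoning)
open import Relation.Nullary using (¬_; Dec; yes; no; does; contradiction)
open import Relation.Nullary.Decidable using (True; toWitness; dec-true; dec-false; decidable-stable)
open import Relation.Unary using (Pred)

-- Where 4 and 5 come from: take one of four points as origin and call the others x, y, w. A
-- reflection preserves three distinct points 0, x, y only if x + y = 0, x = 2y or y = 2x. Imposed
-- on the three triangles through 0, this makes all four points multiples of one element: 0, 1, 2, 3
-- modulo 4, four residues modulo 5, or 0, 1, 2, 4 modulo 7. The hypothesis excludes the first two.
-- The heptagon is compatible with it and falls only because the quadruple itself has no axis, so
-- all four points have to be flipped as well.
--
-- The obstacle throughout is that listed points may coincide in unknown ways. Lists are therefore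
-- read modulo two, and every argument is a search: an entry that must cancel equals some other
-- entry, which is a linear equation. Only integer combinations of such equations are available,
-- since the group has torsion and nothing can be divided.
--
-- The excluded configuration also arises around a center that may lie outside W, where no flip is
-- allowed; hence the lemma about it keeps the center apart from W.

private
  variable
    c ℓ : Level
    n : ℕ

-- Linear equations in an abelian group, by reflection

module LinearEquations (G : AbelianGroup c ℓ) where

  open AbelianGroup G renaming (_∙_ to _+_)
  open AbelianGroupProperties G using (∙-cancelˡ)
  private
    module CM = CommutativeMonoidSolver commutativeMonoid
    open CommutativeMonoidNormal commutativeMonoid using (correct)

  infixl 6 _⊕_ _⊖_
  infix 4 _≐_

  data Term (n : ℕ) : Set where
    var     : Fin n → Term n
    𝟘       : Term n
    _⊕_ _⊖_ : Term n → Term n → Term n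

  record Equation (n : ℕ) : Set where
    constructor _≐_
    field
      lhs rhs : Term n

  open Equation

  -- A commutative monoid solver has no inverses, so a term is split into the summands that count
  -- positively and those that count negatively; `value` relates the two without subtracting.
  positive negative : Term n → CM.Expr n
  positive (var i) = CM.var i
  positive 𝟘       = CM.id
  positive (s ⊕ t) = positive s CM.⊕ positive t
  positive (s ⊖ t) = positive s CM.⊕ negative t
  negative (var i) = CM.id
  negative 𝟘       = CM.id
  negative (s ⊕ t) = negative s CM.⊕ negative t
  negative (s ⊖ t) = negative s CM.⊕ positive t

  -- Two equations whose (lhs − rhs) agree as integer combinations of the
  -- variables; every term is moved to the side on which it counts positively.
  Same : (e e′ : Equation n) → Set
  Same (l ≐ r) (l′ ≐ r′) = True
    (CM.normalise ((positive l CM.⊕ negative r) CM.⊕ (positive r′ CM.⊕ negative l′)) CM.≟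
     CM.normalise ((positive r CM.⊕ negative l) CM.⊕ (positive l′ CM.⊕ negative r′)))

  module In (ρ : Vec Carrier n) where

    ⟦_⟧ : Term n → Carrier
    ⟦ var i ⟧ = Vec.lookup ρ i
    ⟦ 𝟘 ⟧     = ε
    ⟦ s ⊕ t ⟧ = ⟦ s ⟧ + ⟦ t ⟧
    ⟦ s ⊖ t ⟧ = ⟦ s ⟧ - ⟦ t ⟧

    infix 3 ⊢_

    record ⊢_ (e : Equation n) : Set ℓ where
      constructor ⟨_⟩
      field
        holds : ⟦ lhs e ⟧ ≈ ⟦ rhs e ⟧

    open ⊢_ public

    private
      cancel-minus : ∀ x y → (x - y) + y ≈ x
      cancel-minus x y = trans (assoc _ _ _) (trans (∙-congˡ (inverseˡ y)) (identityʳ x))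

    value : ∀ t → ⟦ t ⟧ + CM.⟦ negative t ⟧ ρ ≈ CM.⟦ positive t ⟧ ρ
    value (var i) = identityʳ _
    value 𝟘       = identityʳ _
    value (s ⊕ t) = trans
      (CM.solve 4 (λ s t s⁻ t⁻ → (s CM.⊕ t) CM.⊕ (s⁻ CM.⊕ t⁻) CM.⊜ (s CM.⊕ s⁻) CM.⊕ (t CM.⊕ t⁻))
        refl ⟦ s ⟧ ⟦ t ⟧ _ _)
      (∙-cong (value s) (value t))
    value (s ⊖ t) = trans (∙-congˡ (∙-congˡ (sym (value t)))) (trans
      (CM.solve 4 (λ s-t t s⁻ t⁻ → s-t CM.⊕ (s⁻ CM.⊕ (t CM.⊕ t⁻)) CM.⊜ ((s-t CM.⊕ t) CM.⊕ s⁻) CM.⊕ t⁻)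
        refl (⟦ s ⟧ - ⟦ t ⟧) ⟦ t ⟧ _ _)
      (∙-congʳ (trans (∙-congʳ (cancel-minus _ _)) (value s))))

    infixl 4 _⊹_ _∸_

    _⊹_ : ∀ {l r l′ r′} → ⊢ l ≐ r → ⊢ l′ ≐ r′ → ⊢ l ⊕ l′ ≐ r ⊕ r′
    ⟨ p ⟩ ⊹ ⟨ q ⟩ = ⟨ ∙-cong p q ⟩

    _∸_ : ∀ {l r l′ r′} → ⊢ l ≐ r → ⊢ l′ ≐ r′ → ⊢ l ⊖ l′ ≐ r ⊖ r′
    ⟨ p ⟩ ∸ ⟨ q ⟩ = ⟨ ∙-cong p (⁻¹-cong q) ⟩

    swap : ∀ {l r} → ⊢ l ≐ r → ⊢ r ≐ l
    swap ⟨ p ⟩ = ⟨ sym p ⟩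

    -- Adding `K`, which contains the negative parts of all four sides, turns everything into sums,
    -- where monoid normal forms decide; `K` is cancelled at the end.
    from : ∀ {e e′} → ⊢ e → {Same e e′} → ⊢ e′
    from {l ≐ r} {l′ ≐ r′} ⟨ p ⟩ {same} = ⟨ sym (∙-cancelˡ K _ _ (begin
      K + ⟦ r′ ⟧
        ≈⟨ CM.solve 6 (λ l l⁻ r⁻ l′⁻ r′⁻ r′ →
             (l CM.⊕ l⁻ CM.⊕ r⁻ CM.⊕ l′⁻ CM.⊕ r′⁻) CM.⊕ r′ CM.⊜
             ((l CM.⊕ l⁻) CM.⊕ r⁻) CM.⊕ ((r′ CM.⊕ r′⁻) CM.⊕ l′⁻)) refl _ _ _ _ _ _ ⟩
      ((⟦ l ⟧ + l⁻) + r⁻) + ((⟦ r′ ⟧ + r′⁻) + l′⁻)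
        ≈⟨ ∙-cong (∙-congʳ (value l)) (∙-congʳ (value r′)) ⟩
      CM.⟦ e₁ ⟧ ρ
        ≈⟨ correct e₁ ρ ⟨
      CM.⟦ CM.normalise e₁ ⟧⇓ ρ
        ≡⟨ ≡.cong (λ v → CM.⟦ v ⟧⇓ ρ) (toWitness same) ⟩
      CM.⟦ CM.normalise e₂ ⟧⇓ ρ
        ≈⟨ correct e₂ ρ ⟩
      CM.⟦ e₂ ⟧ ρ
        ≈⟨ ∙-cong (∙-congʳ (value r)) (∙-congʳ (value l′)) ⟨
      ((⟦ r ⟧ + r⁻) + l⁻) + ((⟦ l′ ⟧ + l′⁻) + r′⁻)
        ≈⟨ ∙-congʳ (∙-congʳ (∙-congʳ p)) ⟨
      ((⟦ l ⟧ + r⁻) + l⁻) + ((⟦ l′ ⟧ + l′⁻) + r′⁻)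
        ≈⟨ CM.solve 6 (λ l l⁻ r⁻ l′⁻ r′⁻ l′ →
             ((l CM.⊕ r⁻) CM.⊕ l⁻) CM.⊕ ((l′ CM.⊕ l′⁻) CM.⊕ r′⁻) CM.⊜
             (l CM.⊕ l⁻ CM.⊕ r⁻ CM.⊕ l′⁻ CM.⊕ r′⁻) CM.⊕ l′) refl _ _ _ _ _ _ ⟩
      K + ⟦ l′ ⟧ ∎)) ⟩
      where
      open import Relation.Binary.Reasoning.Setoid setoid
      e₁ e₂ : CM.Expr n
      e₁ = (positive l CM.⊕ negative r) CM.⊕ (positive r′ CM.⊕ negative l′)
      e₂ = (positive r CM.⊕ negative l) CM.⊕ (positive l′ CM.⊕ negative r′)
      l⁻ r⁻ l′⁻ r′⁻ K : Carrier
      l⁻ = CM.⟦ negative l ⟧ ρ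
      r⁻ = CM.⟦ negative r ⟧ ρ
      l′⁻ = CM.⟦ negative l′ ⟧ ρ
      r′⁻ = CM.⟦ negative r′ ⟧ ρ
      K = ⟦ l ⟧ + (l⁻ + (r⁻ + (l′⁻ + r′⁻)))

    identity-law : ∀ {e} → {Same (𝟘 ≐ 𝟘) e} → ⊢ e
    identity-law {e} {same} = from {𝟘 ≐ 𝟘} {e} ⟨ refl ⟩ {same}

-- Two-colorings of an abelian group and the points where a symmetry fails

module Colorings (G : AbelianGroup c ℓ) (_≟_ : Decidable (AbelianGroup._≈_ G)) where

  open AbelianGroup G renaming (_∙_ to _+_)
  open LinearEquations G

  private

    xor-interchange : ∀ a b c d → (a xor b) xor (c xor d) ≡ (a xor c) xor (b xor d)
    xor-interchange a b c d = ≡.trans (xor-assoc a b (c xor d)) (≡.trans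
      (≡.cong (a xor_) (≡.trans (≡.sym (xor-assoc b c d))
        (≡.trans (≡.cong (_xor d) (xor-comm b c)) (xor-assoc c b d))))
      (≡.sym (xor-assoc a c (b xor d))))

    xor-cancel : ∀ a b c → (a xor b) xor (b xor c) ≡ a xor c
    xor-cancel a b c = ≡.trans (xor-assoc a b (b xor c))
      (≡.cong (a xor_) (≡.trans (≡.sym (xor-assoc b b c)) (≡.cong (_xor c) (xor-same b))))

    xor-transpose : ∀ a b c d → a xor b ≡ c xor d → a xor c ≡ b xor d
    xor-transpose a b c d eq = begin
      a xor c                       ≡⟨ xor-cancel a b c ⟨
      (a xor b) xor (b xor c)       ≡⟨ ≡.cong (_xor (b xor c)) eq ⟩
      (c xor d) xor (b xor c)       ≡⟨ xor-comm (c xor d) (b xor c) ⟩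
      (b xor c) xor (c xor d)       ≡⟨ xor-cancel b c d ⟩
      b xor d                       ∎
      where open ≡-Reasoning

    xor-false⇒≡ : ∀ a b → a xor b ≡ false → b ≡ a
    xor-false⇒≡ a b eq = ≡.sym (≡.trans (≡.sym (xor-identityʳ a))
      (≡.trans (xor-transpose a b false false eq) (xor-identityʳ b)))

  δ : Carrier → Carrier → Bool
  δ x t = does (x ≟ t)

  δ-≈ : ∀ {x t} → x ≈ t → δ x t ≡ true
  δ-≈ {x} {t} = dec-true (x ≟ t)

  δ-≉ : ∀ {x t} → ¬ x ≈ t → δ x t ≡ false
  δ-≉ {x} {t} = dec-false (x ≟ t)

  δ-cong₂ : ∀ {x y s t} → (x ≈ s → y ≈ t) → (y ≈ t → x ≈ s) → δ x s ≡ δ y t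
  δ-cong₂ {x} {y} {s} {t} to from with x ≟ s
  ... | yes x≈s = ≡.sym (δ-≈ (to x≈s))
  ... | no x≉s = ≡.sym (δ-≉ (λ y≈t → x≉s (from y≈t)))

  -- Entries of a list may coincide, and a point flipped twice is not flipped at all; hence a count
  -- modulo two instead of membership.
  parity : List Carrier → Carrier → Bool
  parity [] t = false
  parity (x ∷ P) t = δ x t xor parity P t

  parity-cong : ∀ P {s t} → s ≈ t → parity P s ≡ parity P t
  parity-cong [] s≈t = ≡.refl
  parity-cong (x ∷ P) s≈t = ≡.cong₂ _xor_
    (δ-cong₂ (λ e → trans e s≈t) (λ e → trans e (sym s≈t))) (parity-cong P s≈t)

  parity-++ : ∀ P Q t → parity (P ++ Q) t ≡ parity P t xor parity Q t
  parity-++ [] Q t = ≡.refl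
  parity-++ (x ∷ P) Q t = ≡.trans (≡.cong (δ x t xor_) (parity-++ P Q t))
    (≡.sym (xor-assoc (δ x t) _ _))

  parity-translate : ∀ r P t → parity P (t + r) ≡ parity (map (_- r) P) t
  parity-translate r [] t = ≡.refl
  parity-translate r (x ∷ P) t = ≡.cong₂ _xor_
    (δ-cong₂ (λ e → holds (to ⟨ e ⟩)) (λ e → holds (back ⟨ e ⟩))) (parity-translate r P t)
    where
    open In (r ∷ x ∷ t ∷ [])
    R X T : Term 3
    R = var 0F
    X = var 1F
    T = var 2F
    to : ⊢ X ≐ T ⊕ R → ⊢ X ⊖ R ≐ T
    to e = from e
    back : ⊢ X ⊖ R ≐ T → ⊢ X ≐ T ⊕ R
    back e = from e

  parity-reflect : ∀ s P t → parity P (s - t) ≡ parity (map (s -_) P) t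
  parity-reflect s [] t = ≡.refl
  parity-reflect s (x ∷ P) t = ≡.cong₂ _xor_
    (δ-cong₂ (λ e → holds (to ⟨ e ⟩)) (λ e → holds (back ⟨ e ⟩))) (parity-reflect s P t)
    where
    open In (s ∷ x ∷ t ∷ [])
    S X T : Term 3
    S = var 0F
    X = var 1F
    T = var 2F
    to : ⊢ X ≐ S ⊖ T → ⊢ S ⊖ X ≐ T
    to e = from (swap e)
    back : ⊢ S ⊖ X ≐ T → ⊢ X ≐ S ⊖ T
    back e = from (swap e)

  Vanishing : List Carrier → Set _
  Vanishing P = ∀ t → parity P t ≡ false

  Respectful : (Carrier → Bool) → Set _
  Respectful f = ∀ {s t} → s ≈ t → f s ≡ f t

  -- An axis is recorded by the sum of a point and its mirror image, so that no halving occurs: the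
  -- reflection in a point `a` has parameter `a + a`, and `x` lies on the axis `s` when `x + x ≈ s`.
  Reflection : (Carrier → Bool) → Carrier → Set _
  Reflection f s = ∀ t → f (s - t) ≡ f t

  Rotation : (Carrier → Bool) → Carrier → Set _
  Rotation f a = ∀ t → f (t + a) ≡ f t

  -- f changes exactly on P when composed with x ↦ s − x, respectively x ↦ x + a.
  Reflects Translates : (Carrier → Bool) → Carrier → List Carrier → Set _
  Reflects f s P = ∀ t → f t xor f (s - t) ≡ parity P t
  Translates f a P = ∀ t → f t xor f (t + a) ≡ parity P t

  infixl 6 _⊞_

  _⊞_ : (Carrier → Bool) → List Carrier → Carrier → Bool
  (f ⊞ P) t = f t xor parity P t

  ⊞-respectful : ∀ {f} → Respectful f → ∀ P → Respectful (f ⊞ P)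
  ⊞-respectful f-resp P s≈t = ≡.cong₂ _xor_ (f-resp s≈t) (parity-cong P s≈t)

  reflection-by : ∀ {f} s (ρ : Carrier → Carrier) → Respectful f → (∀ t → ρ t ≈ s - t) →
    (∀ t → f (ρ t) ≡ f t) → Reflection f s
  reflection-by s ρ f-resp ρ≈ fρ t = ≡.trans (f-resp (sym (ρ≈ t))) (fρ t)

  reflection-cong : ∀ {f s s′} → Respectful f → s ≈ s′ → Reflection f s → Reflection f s′
  reflection-cong f-resp s≈s′ fs t = ≡.trans (f-resp (∙-congʳ (sym s≈s′))) (fs t)

  rotation-cong : ∀ {f a b} → Respectful f → a ≈ b → Rotation f a → Rotation f b
  rotation-cong f-resp a≈b fa t = ≡.trans (f-resp (∙-congˡ (sym a≈b))) (fa t)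

  reflection-ext : ∀ {f g s} → (∀ t → f t ≡ g t) → Reflection f s → Reflection g s
  reflection-ext f≗g fs t = ≡.trans (≡.sym (f≗g _)) (≡.trans (fs t) (f≗g t))

  reflection∘reflection : ∀ {f s u} → Respectful f →
    Reflection f s → Reflection f u → Rotation f (s - u)
  reflection∘reflection {f} {s} {u} f-resp fs fu t = begin
    f (t + (s - u)) ≡⟨ f-resp (holds shift) ⟩
    f (s - (u - t)) ≡⟨ fs (u - t) ⟩
    f (u - t)       ≡⟨ fu t ⟩
    f t             ∎
    where
    open ≡-Reasoning
    open In (s ∷ u ∷ t ∷ [])
    S U T : Term 3
    S = var 0F
    U = var 1F
    T = var 2F
    shift : ⊢ T ⊕ (S ⊖ U) ≐ S ⊖ (U ⊖ T)
    shift = identity-law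

  rotation∘reflection : ∀ {f s a} → Respectful f →
    Reflection f s → Rotation f a → Reflection f (s + a)
  rotation∘reflection {f} {s} {a} f-resp fs fa t = begin
    f (s + a - t)   ≡⟨ f-resp (holds shift) ⟩
    f ((s - t) + a) ≡⟨ fa (s - t) ⟩
    f (s - t)       ≡⟨ fs t ⟩
    f t             ∎
    where
    open ≡-Reasoning
    open In (s ∷ a ∷ t ∷ [])
    S A T : Term 3
    S = var 0F
    A = var 1F
    T = var 2F
    shift : ⊢ S ⊕ A ⊖ T ≐ (S ⊖ T) ⊕ A
    shift = identity-law

  rotation-inverse : ∀ {f a b} → Respectful f → (∀ t → t + b + a ≈ t) → Rotation f a → Rotation f b
  rotation-inverse {f} {a} {b} f-resp b+a≈0 fa t =
    ≡.trans (≡.sym (fa (t + b))) (f-resp (b+a≈0 t))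

  rotation∘rotation : ∀ {f a b} → Respectful f →
    Rotation f a → Rotation f b → Rotation f (a + b)
  rotation∘rotation {f} {a} {b} f-resp fa fb t =
    ≡.trans (f-resp (sym (assoc t a b))) (≡.trans (fb (t + a)) (fa t))

  -- The flipped coloring is symmetric, so `f` fails to be so only through the flips: at the flipped
  -- points and at their mirror images.
  reflects : ∀ {f u} P → Reflection (f ⊞ P) u → Reflects f u (P ++ map (u -_) P)
  reflects {f} {u} P fu t = begin
    f t xor f (u - t)                       ≡⟨ xor-transpose (f t) _ _ _ (≡.sym (fu t)) ⟩
    parity P t xor parity P (u - t)         ≡⟨ ≡.cong (parity P t xor_) (parity-reflect u P t) ⟩
    parity P t xor parity (map (u -_) P) t  ≡⟨ parity-++ P _ t ⟨
    parity (P ++ map (u -_) P) t            ∎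
    where open ≡-Reasoning

  vanishing⇒reflection : ∀ {f s P} → Reflects f s P → Vanishing P → Reflection f s
  vanishing⇒reflection fs P≡0 t = xor-false⇒≡ _ _ (≡.trans (fs t) (P≡0 t))

  vanishing⇒rotation : ∀ {f a P} → Translates f a P → Vanishing P → Rotation f a
  vanishing⇒rotation fa P≡0 t = xor-false⇒≡ _ _ (≡.trans (fa t) (P≡0 t))

  reflection⇒vanishing : ∀ {f s P} → Reflects f s P → Reflection f s → Vanishing P
  reflection⇒vanishing {f} fP fs t = ≡.trans (≡.sym (fP t))
    (≡.trans (≡.cong (f t xor_) (fs t)) (xor-same (f t)))

  -- The translation by `s - u` is the reflection in `u` followed by the one in `s`, and the latter
  -- does not affect `f`.
  translates : ∀ {f s u P} → Respectful f → Reflection f s → Reflects f u P →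
    Translates f (s - u) P
  translates {f} {s} {u} f-resp fs fu t = ≡.trans
    (≡.cong (f t xor_) (≡.trans (f-resp (holds shift)) (fs (u - t)))) (fu t)
    where
    open In (s ∷ u ∷ t ∷ [])
    S U T : Term 3
    S = var 0F
    U = var 1F
    T = var 2F
    shift : ⊢ T ⊕ (S ⊖ U) ≐ S ⊖ (U ⊖ T)
    shift = identity-law

  translates-+ : ∀ {f a b P Q} → Respectful f → Translates f a P → Translates f b Q →
    Translates f (a + b) (P ++ map (_- a) Q)
  translates-+ {f} {a} {b} {P} {Q} f-resp fa fb t = begin
    f t xor f (t + (a + b))
      ≡⟨ ≡.cong (f t xor_) (f-resp (sym (assoc t a b))) ⟩
    f t xor f (t + a + b)
      ≡⟨ xor-cancel (f t) (f (t + a)) _ ⟨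
    (f t xor f (t + a)) xor (f (t + a) xor f (t + a + b))
      ≡⟨ ≡.cong₂ _xor_ (fa t) (≡.trans (fb (t + a)) (parity-translate a Q t)) ⟩
    parity P t xor parity (map (_- a) Q) t
      ≡⟨ parity-++ P _ t ⟨
    parity (P ++ map (_- a) Q) t ∎
    where open ≡-Reasoning

  translates-inverse : ∀ {f a b P} → Respectful f → (∀ t → t + b + a ≈ t) → Translates f a P →
    Translates f b (map (_- b) P)
  translates-inverse {f} {a} {b} {P} f-resp b+a≈0 fa t = begin
    f t xor f (t + b)           ≡⟨ xor-comm (f t) (f (t + b)) ⟩
    f (t + b) xor f t           ≡⟨ ≡.cong (f (t + b) xor_) (f-resp (b+a≈0 t)) ⟨
    f (t + b) xor f (t + b + a) ≡⟨ fa (t + b) ⟩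
    parity P (t + b)            ≡⟨ parity-translate b P t ⟩
    parity (map (_- b) P) t     ∎
    where open ≡-Reasoning

  -- The source of all relations in `axes`: two descriptions of the same change set cancel each
  -- other.
  translates-unique : ∀ {f a b P Q} → Respectful f → a ≈ b →
    Translates f a P → Translates f b Q → Vanishing (P ++ Q)
  translates-unique {f} {a} {b} {P} {Q} f-resp a≈b fa fb t = begin
    parity (P ++ Q) t          ≡⟨ parity-++ P Q t ⟩
    parity P t xor parity Q t  ≡⟨ ≡.cong (_xor parity Q t) (≡.trans (≡.sym (fa t))
                                    (≡.trans (≡.cong (f t xor_) (f-resp (∙-congˡ a≈b))) (fb t))) ⟩
    parity Q t xor parity Q t  ≡⟨ xor-same (parity Q t) ⟩
    false                      ∎
    where open ≡-Reasoning

  module Partners (ρ : Vec Carrier n) where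

    open In ρ public

    points : List (Term n) → List Carrier
    points = map ⟦_⟧

    odd⇒Any : ∀ P T → parity (points P) ⟦ T ⟧ ≡ true → Any (λ Q → ⊢ T ≐ Q) P
    odd⇒Any (Q ∷ P) T odd with ⟦ Q ⟧ ≟ ⟦ T ⟧
    ... | yes Q≈T = here ⟨ sym Q≈T ⟩
    ... | no _ = there (odd⇒Any P T odd)

    even-partner : ∀ P T → parity (points (T ∷ P)) ⟦ T ⟧ ≡ false → Any (λ Q → ⊢ T ≐ Q) P
    even-partner P T even = odd⇒Any P T (true-xor-false (≡.trans
      (≡.cong (_xor parity (points P) ⟦ T ⟧) (≡.sym (δ-≈ refl))) even))
      where
      true-xor-false : ∀ {b} → true xor b ≡ false → b ≡ true
      true-xor-false {true} _ = ≡.refl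

    parity-extract : ∀ P i t → parity (points P) t ≡ parity (points (lookup P i ∷ removeAt P i)) t
    parity-extract (Q ∷ P) zero t = ≡.refl
    parity-extract (Q ∷ P) (suc i) t = begin
      δ x t xor parity (points P) t                          ≡⟨ ≡.cong (δ x t xor_) (parity-extract P i t) ⟩
      δ x t xor (δ y t xor parity (points (removeAt P i)) t) ≡⟨ xor-assoc (δ x t) (δ y t) _ ⟨
      (δ x t xor δ y t) xor parity (points (removeAt P i)) t ≡⟨ ≡.cong (_xor parity (points (removeAt P i)) t) (xor-comm (δ x t) (δ y t)) ⟩
      (δ y t xor δ x t) xor parity (points (removeAt P i)) t ≡⟨ xor-assoc (δ y t) (δ x t) _ ⟩
      δ y t xor (δ x t xor parity (points (removeAt P i)) t) ∎
      where
      open ≡-Reasoning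
      x y : Carrier
      x = ⟦ Q ⟧
      y = ⟦ lookup P i ⟧

    -- Makes parity usable: matching on the result yields one linear equation per remaining entry.
    -- Entries are kept as terms so that these equations can be fed to `from`.
    partner : ∀ P i → Vanishing (points P) → Any (λ Q → ⊢ lookup P i ≐ Q) (removeAt P i)
    partner P i P≡0 = even-partner (removeAt P i) (lookup P i)
      (≡.trans (≡.sym (parity-extract P i ⟦ lookup P i ⟧)) (P≡0 ⟦ lookup P i ⟧))

    parity-cancel : ∀ P i j → ⊢ lookup P i ≐ lookup (removeAt P i) j → ∀ t →
      parity (points P) t ≡ parity (points (removeAt (removeAt P i) j)) t
    parity-cancel P i j ⟨ p≈q ⟩ t = begin
      parity (points P) t                        ≡⟨ parity-extract P i t ⟩
      δ p t xor parity (points P′) t             ≡⟨ ≡.cong₂ _xor_ (δ-cong₂ (trans (sym p≈q)) (trans p≈q))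
                                                      (parity-extract P′ j t) ⟩
      δ q t xor (δ q t xor parity (points P″) t) ≡⟨ xor-assoc (δ q t) (δ q t) _ ⟨
      (δ q t xor δ q t) xor parity (points P″) t ≡⟨ ≡.cong (_xor parity (points P″) t) (xor-same (δ q t)) ⟩
      parity (points P″) t                       ∎
      where
      open ≡-Reasoning
      P′ P″ : List (Term n)
      P′ = removeAt P i
      P″ = removeAt P′ j
      p q : Carrier
      p = ⟦ lookup P i ⟧
      q = ⟦ lookup P′ j ⟧

    cancel : ∀ P i j → ⊢ lookup P i ≐ lookup (removeAt P i) j → Vanishing (points P) →
      Vanishing (points (removeAt (removeAt P i) j))
    cancel P i j p≐q even t = ≡.trans (≡.sym (parity-cancel P i j p≐q t)) (even t)

    partner-of-two : ∀ S T → Vanishing (points (S ∷ T ∷ [])) → ⊢ S ≐ T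
    partner-of-two S T even = only (partner (S ∷ T ∷ []) 0F even)
      where
      only : Any (λ Q → ⊢ S ≐ Q) (T ∷ []) → ⊢ S ≐ T
      only (here e) = e

  translates-flip : ∀ {f a} P → Rotation (f ⊞ P) a → Translates f a (P ++ map (_- a) P)
  translates-flip {f} {a} P fa t = begin
    f t xor f (t + a)                       ≡⟨ xor-transpose (f t) _ _ _ (≡.sym (fa t)) ⟩
    parity P t xor parity P (t + a)         ≡⟨ ≡.cong (parity P t xor_) (parity-translate a P t) ⟩
    parity P t xor parity (map (_- a) P) t  ≡⟨ parity-++ P _ t ⟨
    parity (P ++ map (_- a) P) t            ∎
    where open ≡-Reasoning

  translates-⊞ : ∀ {f a P} B → Translates f a P → Translates (f ⊞ B) a (P ++ B ++ map (_- a) B)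
  translates-⊞ {f} {a} {P} B fa t = begin
    (f t xor parity B t) xor (f (t + a) xor parity B (t + a))
      ≡⟨ xor-interchange (f t) _ _ _ ⟩
    (f t xor f (t + a)) xor (parity B t xor parity B (t + a))
      ≡⟨ ≡.cong₂ _xor_ (fa t) (≡.cong (parity B t xor_) (parity-translate a B t)) ⟩
    parity P t xor (parity B t xor parity (map (_- a) B) t)
      ≡⟨ ≡.cong (parity P t xor_) (parity-++ B _ t) ⟨
    parity P t xor parity (B ++ map (_- a) B) t
      ≡⟨ parity-++ P _ t ⟨
    parity (P ++ B ++ map (_- a) B) t ∎
    where open ≡-Reasoning

  translates-swap : ∀ {f a x y} → Translates f a (x ∷ y ∷ []) → Translates f a (y ∷ x ∷ [])
  translates-swap {f} {a} {x} {y} fa t = ≡.trans (fa t) (xor-swap (δ x t) (δ y t))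
    where
    xor-swap : ∀ b c → b xor (c xor false) ≡ c xor (b xor false)
    xor-swap b c = ≡.trans (≡.cong (b xor_) (xor-identityʳ c))
      (≡.trans (xor-comm b c) (≡.cong (c xor_) (≡.sym (xor-identityʳ b))))

  ⊞-self : ∀ f x B t → (f ⊞ (x ∷ [])) t xor parity (x ∷ B) t ≡ (f ⊞ B) t
  ⊞-self f x B t = ≡.trans
    (≡.cong (λ b → (f t xor b) xor parity (x ∷ B) t) (xor-identityʳ (δ x t)))
    (≡.trans (xor-assoc (f t) (δ x t) _) (≡.cong (f t xor_)
      (≡.trans (≡.sym (xor-assoc (δ x t) (δ x t) _)) (≡.cong (_xor parity B t) (xor-same (δ x t))))))

  translates-periodic : ∀ {f a b P} → Respectful f → Rotation f a → Translates f b P →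
    ∀ t → parity P (t + a) ≡ parity P t
  translates-periodic {f} {a} {b} {P} f-resp fa fP t = begin
    parity P (t + a)              ≡⟨ fP (t + a) ⟨
    f (t + a) xor f (t + a + b)   ≡⟨ ≡.cong₂ _xor_ (fa t) (≡.trans (f-resp (holds shift)) (fa (t + b))) ⟩
    f t xor f (t + b)             ≡⟨ fP t ⟩
    parity P t                    ∎
    where
    open ≡-Reasoning
    open In (a ∷ b ∷ t ∷ [])
    A B T : Term 3
    A = var 0F
    B = var 1F
    T = var 2F
    shift : ⊢ T ⊕ A ⊕ B ≐ T ⊕ B ⊕ A
    shift = identity-law

  -- A reflection turns the rotation by `a` into its inverse, which preserves `f` too; so the change
  -- set inherits the period.
  reflects-periodic : ∀ {f s a P} → Respectful f → Rotation f a → Reflects f s P →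
    ∀ t → parity P (t + a) ≡ parity P t
  reflects-periodic {f} {s} {a} {P} f-resp fa fP t = begin
    parity P (t + a)            ≡⟨ fP (t + a) ⟨
    f (t + a) xor f (s - (t + a)) ≡⟨ ≡.cong₂ _xor_ (fa t) (≡.trans (≡.sym (fa (s - (t + a)))) (f-resp (holds shift))) ⟩
    f t xor f (s - t)           ≡⟨ fP t ⟩
    parity P t                  ∎
    where
    open ≡-Reasoning
    open In (s ∷ a ∷ t ∷ [])
    S A T : Term 3
    S = var 0F
    A = var 1F
    T = var 2F
    shift : ⊢ (S ⊖ (T ⊕ A)) ⊕ A ≐ S ⊖ T
    shift = identity-law

  -- Translation by a = r + r′ would change f only at p and at p + a = s − p, although these
  -- two points have the same color.
  half-turn-trivial : ∀ {f s p m n o r r′} → Respectful f → Reflection f s →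
    Translates f r (p ∷ m ∷ []) → Translates f r′ (n ∷ o ∷ []) →
    m ≈ o - r → n - r ≈ p + (r + r′) → p + p + (r + r′) ≈ s → r + r′ ≈ ε
  half-turn-trivial {f} {s} {p} {m} {n′} {o} {r} {r′} f-resp fs fr fr′ m≈o-r n-r≈p+a 2p+a≈s =
    holds (only (even-partner (N ⊖ R ∷ []) P (≡.trans
      (≡.sym (parity-cancel (P ∷ M ∷ N ⊖ R ∷ O ⊖ R ∷ []) 1F 2F ⟨ m≈o-r ⟩ p)) unchanged)))
    where
    open Partners (p ∷ m ∷ n′ ∷ o ∷ r ∷ r′ ∷ s ∷ [])
    P M N O R R′ S : Term 7
    P = var 0F
    M = var 1F
    N = var 2F
    O = var 3F
    R = var 4F
    R′ = var 5F
    S = var 6F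
    n-r≐p+a : ⊢ N ⊖ R ≐ P ⊕ (R ⊕ R′)
    n-r≐p+a = ⟨ n-r≈p+a ⟩
    2p+a≐s : ⊢ P ⊕ P ⊕ (R ⊕ R′) ≐ S
    2p+a≐s = ⟨ 2p+a≈s ⟩
    only : Any (λ T → ⊢ P ≐ T) (N ⊖ R ∷ []) → ⊢ R ⊕ R′ ≐ 𝟘
    only (here e) = from (swap (e ⊹ n-r≐p+a))
    p+a≐s-p : ⊢ P ⊕ (R ⊕ R′) ≐ S ⊖ P
    p+a≐s-p = from 2p+a≐s
    unchanged : parity (points (P ∷ M ∷ N ⊖ R ∷ O ⊖ R ∷ [])) p ≡ false
    unchanged = ≡.trans
      (≡.sym (translates-+ {P = points (P ∷ M ∷ [])} {Q = points (N ∷ O ∷ [])} f-resp fr fr′ p))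
      (≡.trans (≡.cong (f p xor_) (≡.trans (f-resp (holds p+a≐s-p)) (fs p))) (xor-same (f p)))

-- Symmetric colorings in a group with at most one element of order two

module Symmetries (G : AbelianGroup c ℓ) (_≟_ : Decidable (AbelianGroup._≈_ G)) where

  open AbelianGroup G renaming (_∙_ to _+_)
  open LinearEquations G
  open Colorings G _≟_

  -- The group has at most one element of order two.
  module _ (double-injective : ∀ {x y z} → x + x ≈ y + y → x + x ≈ z + z →
              ¬ x ≈ y → ¬ x ≈ z → ¬ y ≈ z → ⊥) where

    module _ {f} (f-resp : Respectful f) {p} (f-refl : Reflection f (p + p)) where

      -- If {p, x, y} flips to a symmetric coloring although f is itself so symmetric that the
      -- four points look alike, then the triangle must be symmetric.
      isosceles : ∀ {x y w z} → Rotation f (x - p) → Rotation f (y - p) → Rotation f (w - p) →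
        ¬ x ≈ p → ¬ y ≈ p → ¬ w ≈ p → ¬ x ≈ y → ¬ y ≈ w → ¬ x ≈ w →
        Reflection (f ⊞ (p ∷ x ∷ y ∷ [])) z →
        x + y ≈ p + p ⊎ p + x ≈ y + y ⊎ p + y ≈ x + x
      isosceles {x} {y} {w} {z} fx fy fw x≉p y≉p w≉p x≉y y≉w x≉w fz = symmetric fixes
        where
        open Partners (p ∷ x ∷ y ∷ w ∷ z ∷ [])
        P X Y W Z : Term 5
        P = var 0F
        X = var 1F
        Y = var 2F
        W = var 3F
        Z = var 4F
        Q : List (Term 5)
        Q = P ∷ X ∷ Y ∷ Z ⊖ P ∷ Z ⊖ X ∷ Z ⊖ Y ∷ []

        changes : Reflects f z (points Q)
        changes = reflects {f} (p ∷ x ∷ y ∷ []) fz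

        centre : ⊢ P ⊕ P ≐ Z → Reflection f z
        centre ⟨ e ⟩ = reflection-cong f-resp e f-refl

        once : ∀ {a} → Rotation f (a - p) → p + p + (a - p) ≈ z → Reflection f z
        once fa e = reflection-cong f-resp e (rotation∘reflection f-resp f-refl fa)

        twice : ∀ {a b} → Rotation f (a - p) → Rotation f (b - p) →
          p + p + (a - p) + (b - p) ≈ z → Reflection f z
        twice fa fb e = reflection-cong f-resp e
          (rotation∘reflection f-resp (rotation∘reflection f-resp f-refl fa) fb)

        fixes-if-even : Any (λ T → ⊢ P ≐ T) (X ∷ Y ∷ Z ⊖ P ∷ Z ⊖ X ∷ Z ⊖ Y ∷ []) → Reflection f z
        fixes-if-even (here e) = ⊥-elim (x≉p (holds (swap e)))
        fixes-if-even (there (here e)) = ⊥-elim (y≉p (holds (swap e)))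
        fixes-if-even (there (there (here e))) = centre (from e)
        fixes-if-even (there (there (there (here e)))) =
          once fx (holds (from {e′ = P ⊕ P ⊕ (X ⊖ P) ≐ Z} e))
        fixes-if-even (there (there (there (there (here e))))) =
          once fy (holds (from {e′ = P ⊕ P ⊕ (Y ⊖ P) ≐ Z} e))

        fixes-if-odd : Any (λ T → ⊢ W ≐ T) Q → Reflection f z
        fixes-if-odd (here e) = ⊥-elim (w≉p (holds e))
        fixes-if-odd (there (here e)) = ⊥-elim (x≉w (holds (swap e)))
        fixes-if-odd (there (there (here e))) = ⊥-elim (y≉w (holds (swap e)))
        fixes-if-odd (there (there (there (here e)))) =
          once fw (holds (from {e′ = P ⊕ P ⊕ (W ⊖ P) ≐ Z} e))
        fixes-if-odd (there (there (there (there (here e))))) =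
          twice fw fx (holds (from {e′ = P ⊕ P ⊕ (W ⊖ P) ⊕ (X ⊖ P) ≐ Z} e))
        fixes-if-odd (there (there (there (there (there (here e)))))) =
          twice fw fy (holds (from {e′ = P ⊕ P ⊕ (W ⊖ P) ⊕ (Y ⊖ P) ≐ Z} e))

        -- Either `P` cancels in `Q`, or it is odd and the period `w - p` makes `W` odd in `Q` as
        -- well. Each coincidence that is possible expresses `Z` as an axis generated by the known
        -- symmetries.
        fixes : Reflection f z
        fixes with parity (points Q) p in eq
        ... | false = fixes-if-even (even-partner _ P eq)
        ... | true = fixes-if-odd (odd⇒Any Q W (≡.trans (parity-cong (points Q) (holds w-shift))
          (≡.trans (reflects-periodic {P = points Q} f-resp fw changes p) eq)))
          where
          w-shift : ⊢ W ≐ P ⊕ (W ⊖ P)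
          w-shift = identity-law

        symmetric : Reflection f z → x + y ≈ p + p ⊎ p + x ≈ y + y ⊎ p + y ≈ x + x
        symmetric fz = image-of-p (partner Q 0F even)
          where
          even : Vanishing (points Q)
          even = reflection⇒vanishing {f} {P = points Q} changes fz

          image-of-x : ⊢ P ≐ Z ⊖ P → Vanishing (points (X ∷ Y ∷ Z ⊖ X ∷ Z ⊖ Y ∷ [])) →
            Any (λ T → ⊢ X ≐ T) (Y ∷ Z ⊖ X ∷ Z ⊖ Y ∷ []) → _
          image-of-x e₀ even′ (here e) = ⊥-elim (x≉y (holds e))
          -- Here the reflection would fix `P`, `X` and `Y`, but it has at most two fixed points.
          image-of-x e₀ even′ (there (here e)) = ⊥-elim (double-injective
            (holds (from {e′ = P ⊕ P ≐ X ⊕ X} (e₀ ∸ e)))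
            (holds (from {e′ = P ⊕ P ≐ Y ⊕ Y} (e₀ ∸ partner-of-two Y (Z ⊖ Y)
              (cancel (X ∷ Y ∷ Z ⊖ X ∷ Z ⊖ Y ∷ []) 0F 1F e even′))))
            (λ e → x≉p (sym e)) (λ e → y≉p (sym e)) x≉y)
          image-of-x e₀ even′ (there (there (here e))) =
            inj₁ (holds (from {e′ = X ⊕ Y ≐ P ⊕ P} (e ∸ e₀)))

          image-of-p : Any (λ T → ⊢ P ≐ T) (X ∷ Y ∷ Z ⊖ P ∷ Z ⊖ X ∷ Z ⊖ Y ∷ []) → _
          image-of-p (here e) = ⊥-elim (x≉p (holds (swap e)))
          image-of-p (there (here e)) = ⊥-elim (y≉p (holds (swap e)))
          image-of-p (there (there (here e))) =
            image-of-x e even′ (partner (X ∷ Y ∷ Z ⊖ X ∷ Z ⊖ Y ∷ []) 0F even′)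
            where
            even′ : Vanishing (points (X ∷ Y ∷ Z ⊖ X ∷ Z ⊖ Y ∷ []))
            even′ = cancel Q 0F 2F e even
          image-of-p (there (there (there (here e)))) =
            inj₂ (inj₁ (holds (from {e′ = P ⊕ X ≐ Y ⊕ Y} (e ∸ partner-of-two Y (Z ⊖ Y)
              (cancel (X ∷ Y ∷ Z ⊖ P ∷ Z ⊖ Y ∷ []) 0F 1F (from e)
                (cancel Q 0F 3F e even))))))
          image-of-p (there (there (there (there (here e))))) =
            inj₂ (inj₂ (holds (from {e′ = P ⊕ Y ≐ X ⊕ X} (e ∸ partner-of-two X (Z ⊖ X)
              (cancel (X ∷ Y ∷ Z ⊖ P ∷ Z ⊖ X ∷ []) 1F 1F (from e)
                (cancel Q 0F 4F e even))))))

      -- With p as origin the points are x, 2x, 4x, 8x = x: together with p, four vertices of a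
      -- regular heptagon, which form no symmetric quadrilateral.
      no-heptagon : ∀ {x y w z} → Rotation f (x - p) → Rotation f (y - p) → Rotation f (w - p) →
        ¬ x ≈ p → ¬ y ≈ p → ¬ w ≈ p → ¬ x ≈ y → ¬ y ≈ w → ¬ x ≈ w →
        x + x ≈ p + y → y + y ≈ p + w → w + w ≈ p + x →
        ¬ Reflection (f ⊞ (p ∷ x ∷ y ∷ w ∷ [])) z
      no-heptagon {x} {y} {w} {z} fx fy fw x≉p y≉p w≉p x≉y y≉w x≉w 2x≈p+y 2y≈p+w 2w≈p+x fz =
        image-of-p (partner Q 0F even)
        where
        open Partners (p ∷ x ∷ y ∷ w ∷ z ∷ [])
        P X Y W Z : Term 5
        P = var 0F
        X = var 1F
        Y = var 2F
        W = var 3F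
        Z = var 4F
        Q : List (Term 5)
        Q = P ∷ X ∷ Y ∷ W ∷ Z ⊖ P ∷ Z ⊖ X ∷ Z ⊖ Y ∷ Z ⊖ W ∷ []

        x≢p : ¬ (⊢ X ≐ P)
        x≢p e = x≉p (holds e)
        y≢p : ¬ (⊢ Y ≐ P)
        y≢p e = y≉p (holds e)
        w≢p : ¬ (⊢ W ≐ P)
        w≢p e = w≉p (holds e)
        x≢y : ¬ (⊢ X ≐ Y)
        x≢y e = x≉y (holds e)
        y≢w : ¬ (⊢ Y ≐ W)
        y≢w e = y≉w (holds e)
        x≢w : ¬ (⊢ X ≐ W)
        x≢w e = x≉w (holds e)
        r₁ : ⊢ X ⊕ X ≐ P ⊕ Y
        r₁ = ⟨ 2x≈p+y ⟩
        r₂ : ⊢ Y ⊕ Y ≐ P ⊕ W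
        r₂ = ⟨ 2y≈p+w ⟩
        r₃ : ⊢ W ⊕ W ≐ P ⊕ X
        r₃ = ⟨ 2w≈p+x ⟩

        changes : Reflects f z (points Q)
        changes = reflects {f} (p ∷ x ∷ y ∷ w ∷ []) fz

        once : ∀ {a} → Rotation f (a - p) → p + p + (a - p) ≈ z → Reflection f z
        once fa e = reflection-cong f-resp e (rotation∘reflection f-resp f-refl fa)

        thrice : ∀ {a} → Rotation f (a - p) → p + p + (x - p) + (y - p) + (a - p) ≈ z → Reflection f z
        thrice fa e = reflection-cong f-resp e (rotation∘reflection f-resp (rotation∘reflection f-resp
          (rotation∘reflection f-resp f-refl fx) fy) fa)

        fixes-if-even : Any (λ T → ⊢ P ≐ T) (X ∷ Y ∷ W ∷ Z ⊖ P ∷ Z ⊖ X ∷ Z ⊖ Y ∷ Z ⊖ W ∷ []) →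
          Reflection f z
        fixes-if-even (here e) = ⊥-elim (x≢p (swap e))
        fixes-if-even (there (here e)) = ⊥-elim (y≢p (swap e))
        fixes-if-even (there (there (here e))) = ⊥-elim (w≢p (swap e))
        fixes-if-even (there (there (there (here e)))) =
          reflection-cong f-resp (holds (from {e′ = P ⊕ P ≐ Z} e)) f-refl
        fixes-if-even (there (there (there (there (here e))))) =
          once fx (holds (from {e′ = P ⊕ P ⊕ (X ⊖ P) ≐ Z} e))
        fixes-if-even (there (there (there (there (there (here e)))))) =
          once fy (holds (from {e′ = P ⊕ P ⊕ (Y ⊖ P) ≐ Z} e))
        fixes-if-even (there (there (there (there (there (there (here e))))))) =
          once fw (holds (from {e′ = P ⊕ P ⊕ (W ⊖ P) ≐ Z} e))

        -- If `P`, `X`, `Y`, `W` are the vertices 0, 1, 2, 4, then `X ⊕ Y ⊖ P` is the vertex 3. It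
        -- is none of the four, so it can only be the mirror image of one.
        fixes-if-odd : Any (λ T → ⊢ X ⊕ Y ⊖ P ≐ T) Q → Reflection f z
        fixes-if-odd (here e) = ⊥-elim (x≢w (from (r₂ ⊹ r₁ ∸ e)))
        fixes-if-odd (there (here e)) = ⊥-elim (y≢p (from e))
        fixes-if-odd (there (there (here e))) = ⊥-elim (x≢p (from e))
        fixes-if-odd (there (there (there (here e)))) = ⊥-elim (x≢y (from (e ∸ r₂)))
        fixes-if-odd (there (there (there (there (here e))))) = reflection-cong f-resp
          (holds (from {e′ = P ⊕ P ⊕ (X ⊖ P) ⊕ (Y ⊖ P) ≐ Z} e))
          (rotation∘reflection f-resp (rotation∘reflection f-resp f-refl fx) fy)
        fixes-if-odd (there (there (there (there (there (here e)))))) =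
          thrice fx (holds (from {e′ = P ⊕ P ⊕ (X ⊖ P) ⊕ (Y ⊖ P) ⊕ (X ⊖ P) ≐ Z} e))
        fixes-if-odd (there (there (there (there (there (there (here e))))))) =
          thrice fy (holds (from {e′ = P ⊕ P ⊕ (X ⊖ P) ⊕ (Y ⊖ P) ⊕ (Y ⊖ P) ≐ Z} e))
        fixes-if-odd (there (there (there (there (there (there (there (here e)))))))) =
          thrice fw (holds (from {e′ = P ⊕ P ⊕ (X ⊖ P) ⊕ (Y ⊖ P) ⊕ (W ⊖ P) ≐ Z} e))

        fixes : Reflection f z
        fixes with parity (points Q) p in eq
        ... | false = fixes-if-even (even-partner _ P eq)
        ... | true = fixes-if-odd (odd⇒Any Q (X ⊕ Y ⊖ P) (≡.trans
          (parity-cong (points Q) (holds shift))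
          (≡.trans (reflects-periodic {P = points Q} f-resp
            (rotation∘rotation f-resp fx fy) changes p) eq)))
          where
          shift : ⊢ X ⊕ Y ⊖ P ≐ P ⊕ ((X ⊖ P) ⊕ (Y ⊖ P))
          shift = identity-law

        even : Vanishing (points Q)
        even = reflection⇒vanishing {f} {P = points Q} changes fixes

        -- The image of 0 leaves the axes 0, 1, 2, 4 modulo 7. They send 1 to 6, 2 to 6, 4 to 5 and
        -- 1 to 3 respectively, outside the quadruple.
        image-of-p : Any (λ T → ⊢ P ≐ T) (X ∷ Y ∷ W ∷ Z ⊖ P ∷ Z ⊖ X ∷ Z ⊖ Y ∷ Z ⊖ W ∷ []) → ⊥
        image-of-p (here e) = x≢p (swap e)
        image-of-p (there (here e)) = y≢p (swap e)
        image-of-p (there (there (here e))) = w≢p (swap e)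
        image-of-p (there (there (there (here e₀)))) = no-image-of-x (partner Q 1F even)
          where
          no-image-of-x : Any (λ T → ⊢ X ≐ T) (P ∷ Y ∷ W ∷ Z ⊖ P ∷ Z ⊖ X ∷ Z ⊖ Y ∷ Z ⊖ W ∷ []) → ⊥
          no-image-of-x (here e) = x≢p (from e)
          no-image-of-x (there (here e)) = x≢y (from e)
          no-image-of-x (there (there (here e))) = x≢w (from e)
          no-image-of-x (there (there (there (here e)))) = x≢p (from (e ∸ e₀))
          no-image-of-x (there (there (there (there (here e))))) = y≢p (from (e ∸ e₀ ∸ r₁))
          no-image-of-x (there (there (there (there (there (here e)))))) = x≢w (from (e₀ ⊹ r₂ ⊹ r₁ ∸ e))
          no-image-of-x (there (there (there (there (there (there (here e))))))) = y≢w (from (e ∸ e₀ ∸ r₃ ∸ r₁))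
        image-of-p (there (there (there (there (here e₀))))) = no-image-of-y (partner Q 2F even)
          where
          no-image-of-y : Any (λ T → ⊢ Y ≐ T) (P ∷ X ∷ W ∷ Z ⊖ P ∷ Z ⊖ X ∷ Z ⊖ Y ∷ Z ⊖ W ∷ []) → ⊥
          no-image-of-y (here e) = y≢p (from e)
          no-image-of-y (there (here e)) = x≢y (from (swap e))
          no-image-of-y (there (there (here e))) = y≢w (from e)
          no-image-of-y (there (there (there (here e)))) = x≢y (from (e₀ ∸ e))
          no-image-of-y (there (there (there (there (here e))))) = y≢p (from (e ∸ e₀))
          no-image-of-y (there (there (there (there (there (here e)))))) = x≢w (from (e₀ ⊹ r₂ ∸ e))
          no-image-of-y (there (there (there (there (there (there (here e))))))) = y≢w (from (e ∸ e₀ ∸ r₃))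
        image-of-p (there (there (there (there (there (here e₀)))))) = no-image-of-w (partner Q 3F even)
          where
          no-image-of-w : Any (λ T → ⊢ W ≐ T) (P ∷ X ∷ Y ∷ Z ⊖ P ∷ Z ⊖ X ∷ Z ⊖ Y ∷ Z ⊖ W ∷ []) → ⊥
          no-image-of-w (here e) = w≢p (from e)
          no-image-of-w (there (here e)) = x≢w (from (swap e))
          no-image-of-w (there (there (here e))) = y≢w (from (swap e))
          no-image-of-w (there (there (there (here e)))) = y≢w (from (e₀ ∸ e))
          no-image-of-w (there (there (there (there (here e))))) = x≢w (from (e₀ ⊹ r₁ ∸ e))
          no-image-of-w (there (there (there (there (there (here e)))))) = w≢p (from (e ∸ e₀))
          no-image-of-w (there (there (there (there (there (there (here e))))))) = x≢y (from (e ∸ e₀ ∸ r₃))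
        image-of-p (there (there (there (there (there (there (here e₀))))))) = no-image-of-x′ (partner Q 1F even)
          where
          no-image-of-x′ : Any (λ T → ⊢ X ≐ T) (P ∷ Y ∷ W ∷ Z ⊖ P ∷ Z ⊖ X ∷ Z ⊖ Y ∷ Z ⊖ W ∷ []) → ⊥
          no-image-of-x′ (here e) = x≢p (from e)
          no-image-of-x′ (there (here e)) = x≢y (from e)
          no-image-of-x′ (there (there (here e))) = x≢w (from e)
          no-image-of-x′ (there (there (there (here e)))) = x≢w (from (e ∸ e₀))
          no-image-of-x′ (there (there (there (there (here e))))) = y≢w (from (e ∸ e₀ ∸ r₁))
          no-image-of-x′ (there (there (there (there (there (here e)))))) = x≢y (from (e ∸ e₀ ∸ r₂))
          no-image-of-x′ (there (there (there (there (there (there (here e))))))) = x≢p (from (e ∸ e₀))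

    module _ {ℓʷ} (W : Carrier → Set ℓʷ)
      (quarter : ∀ {x y} → W x → W y →
        (x + x) + (x + x) ≈ (y + y) + (y + y) → x + x ≈ y + y)
      (fifth : ∀ {x y} → W x → W y →
        (x + x) + (x + x) + x ≈ (y + y) + (y + y) + y → x ≈ y) where

      -- Each of the triangles through `p` must be symmetric, which leaves the square, the pentagon
      -- and the heptagon. `p` is a separate point and only the combined flips `p ∷ B` are assumed
      -- symmetric, so that the lemma also serves a center outside `W`.
      no-concentric : ∀ {f p x y w} → Respectful f → Reflection f (p + p) →
        Rotation f (x - p) → Rotation f (y - p) → Rotation f (w - p) → W x → W y → W w →
        ¬ x ≈ p → ¬ y ≈ p → ¬ w ≈ p → ¬ x ≈ y → ¬ y ≈ w → ¬ x ≈ w →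
        ¬ (∀ B → All W B → ∃ (Reflection (f ⊞ (p ∷ B))))
      no-concentric {f} {p} {x} {y} {w} f-resp f-refl fx fy fw Wx Wy Ww x≉p y≉p w≉p x≉y y≉w x≉w symmetric =
        scalene
          (wrap (isosceles f-resp f-refl fx fy fw x≉p y≉p w≉p x≉y y≉w x≉w
            (proj₂ (symmetric (x ∷ y ∷ []) (Wx ∷ Wy ∷ [])))))
          (wrap (isosceles f-resp f-refl fy fw fx y≉p w≉p x≉p y≉w (λ e → x≉w (sym e)) (λ e → x≉y (sym e))
            (proj₂ (symmetric (y ∷ w ∷ []) (Wy ∷ Ww ∷ [])))))
          (wrap (isosceles f-resp f-refl fx fw fy x≉p w≉p y≉p x≉w (λ e → y≉w (sym e)) x≉y
            (proj₂ (symmetric (x ∷ w ∷ []) (Wx ∷ Ww ∷ [])))))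
        where
        open In (p ∷ x ∷ y ∷ w ∷ [])
        P X Y V : Term 4
        P = var 0F
        X = var 1F
        Y = var 2F
        V = var 3F

        Isosceles : Term 4 → Term 4 → Set ℓ
        Isosceles S T = (⊢ S ⊕ T ≐ P ⊕ P) ⊎ (⊢ P ⊕ S ≐ T ⊕ T) ⊎ (⊢ P ⊕ T ≐ S ⊕ S)

        wrap : ∀ {S T} → ⟦ S ⟧ + ⟦ T ⟧ ≈ p + p ⊎ p + ⟦ S ⟧ ≈ ⟦ T ⟧ + ⟦ T ⟧ ⊎ p + ⟦ T ⟧ ≈ ⟦ S ⟧ + ⟦ S ⟧ →
          Isosceles S T
        wrap = Sum.map ⟨_⟩ (Sum.map ⟨_⟩ ⟨_⟩)

        x≢p : ¬ (⊢ X ≐ P)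
        x≢p e = x≉p (holds e)
        y≢p : ¬ (⊢ Y ≐ P)
        y≢p e = y≉p (holds e)
        w≢p : ¬ (⊢ V ≐ P)
        w≢p e = w≉p (holds e)
        x≢y : ¬ (⊢ X ≐ Y)
        x≢y e = x≉y (holds e)
        y≢w : ¬ (⊢ Y ≐ V)
        y≢w e = y≉w (holds e)
        x≢w : ¬ (⊢ X ≐ V)
        x≢w e = x≉w (holds e)
        quarter-xy : ⊢ (X ⊕ X) ⊕ (X ⊕ X) ≐ (Y ⊕ Y) ⊕ (Y ⊕ Y) → ⊢ X ⊕ X ≐ Y ⊕ Y
        quarter-xy e = ⟨ quarter Wx Wy (holds e) ⟩
        quarter-yw : ⊢ (Y ⊕ Y) ⊕ (Y ⊕ Y) ≐ (V ⊕ V) ⊕ (V ⊕ V) → ⊢ Y ⊕ Y ≐ V ⊕ V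
        quarter-yw e = ⟨ quarter Wy Ww (holds e) ⟩
        fifth-xy : ¬ (⊢ (X ⊕ X) ⊕ (X ⊕ X) ⊕ X ≐ (Y ⊕ Y) ⊕ (Y ⊕ Y) ⊕ Y)
        fifth-xy e = x≉y (fifth Wx Wy (holds e))
        fifth-yw : ¬ (⊢ (Y ⊕ Y) ⊕ (Y ⊕ Y) ⊕ Y ≐ (V ⊕ V) ⊕ (V ⊕ V) ⊕ V)
        fifth-yw e = y≉w (fifth Wy Ww (holds e))

        -- With `p` as origin: one zero sum and a chain of two doublings between the same two points
        -- give a pentagon; one zero sum and two doublings onto the same point give a square; a
        -- cycle of three doublings gives the heptagon. All other combinations identify two points.
        -- `quarter` and `fifth` are applied to two of `x`, `y`, `w`, never to `p`.
        scalene : Isosceles X Y → Isosceles Y V → Isosceles X V → ⊥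
        scalene (inj₁ e₁) (inj₁ e₂) (inj₁ e₃) = x≢y (from (e₃ ∸ e₂))
        scalene (inj₁ e₁) (inj₁ e₂) (inj₂ (inj₁ e₃)) = x≢w (from (e₁ ∸ e₂))
        scalene (inj₁ e₁) (inj₁ e₂) (inj₂ (inj₂ e₃)) = x≢w (from (e₁ ∸ e₂))
        scalene (inj₁ e₁) (inj₂ (inj₁ e₂)) (inj₁ e₃) = y≢w (from (e₁ ∸ e₃))
        scalene (inj₁ e₁) (inj₂ (inj₁ e₂)) (inj₂ (inj₁ e₃)) = x≢y (from (e₃ ∸ e₂))
        scalene (inj₁ e₁) (inj₂ (inj₁ e₂)) (inj₂ (inj₂ e₃)) =
          fifth-yw (from (e₃ ⊹ e₂ ⊹ e₂ ⊹ e₂ ⊹ e₁ ⊹ e₁))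
        scalene (inj₁ e₁) (inj₂ (inj₂ e₂)) (inj₁ e₃) = y≢w (from (e₁ ∸ e₃))
        scalene (inj₁ e₁) (inj₂ (inj₂ e₂)) (inj₂ (inj₁ e₃)) =
          fifth-yw (from (e₃ ∸ e₂ ∸ e₂ ∸ e₂ ∸ e₁))
        scalene (inj₁ e₁) (inj₂ (inj₂ e₂)) (inj₂ (inj₂ e₃)) =
          w≢p (from (swap (quarter-yw (from (swap e₃ ∸ e₂ ∸ e₂ ∸ e₂ ∸ e₁ ∸ e₁))) ∸ e₂))
        scalene (inj₂ (inj₁ e₁)) (inj₁ e₂) (inj₁ e₃) = x≢y (from (e₃ ∸ e₂))
        scalene (inj₂ (inj₁ e₁)) (inj₁ e₂) (inj₂ (inj₁ e₃)) =
          x≢p (from (quarter-xy (from (e₃ ⊹ e₂ ⊹ e₂ ⊹ e₁ ⊹ e₁ ⊹ e₁)) ∸ e₁))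
        scalene (inj₂ (inj₁ e₁)) (inj₁ e₂) (inj₂ (inj₂ e₃)) =
          fifth-xy (from (e₂ ⊹ e₁ ⊹ e₁ ⊹ e₁ ∸ e₃))
        scalene (inj₂ (inj₁ e₁)) (inj₂ (inj₁ e₂)) (inj₁ e₃) =
          fifth-xy (from (e₃ ⊹ e₃ ⊹ e₂ ⊹ e₁ ⊹ e₁ ⊹ e₁))
        scalene (inj₂ (inj₁ e₁)) (inj₂ (inj₁ e₂)) (inj₂ (inj₁ e₃)) = x≢y (from (e₃ ∸ e₂))
        scalene (inj₂ (inj₁ e₁)) (inj₂ (inj₁ e₂)) (inj₂ (inj₂ e₃)) =
          no-heptagon f-resp f-refl fx fw fy x≉p w≉p y≉p x≉w (λ e → y≉w (sym e)) x≉y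
            (sym (holds e₃)) (sym (holds e₂)) (sym (holds e₁))
            (proj₂ (symmetric (x ∷ w ∷ y ∷ []) (Wx ∷ Ww ∷ Wy ∷ [])))
        scalene (inj₂ (inj₁ e₁)) (inj₂ (inj₂ e₂)) (inj₁ e₃) = x≢w (from (e₁ ∸ e₂))
        scalene (inj₂ (inj₁ e₁)) (inj₂ (inj₂ e₂)) (inj₂ (inj₁ e₃)) = x≢w (from (e₁ ∸ e₂))
        scalene (inj₂ (inj₁ e₁)) (inj₂ (inj₂ e₂)) (inj₂ (inj₂ e₃)) = x≢w (from (e₁ ∸ e₂))
        scalene (inj₂ (inj₂ e₁)) (inj₁ e₂) (inj₁ e₃) = x≢y (from (e₃ ∸ e₂))
        scalene (inj₂ (inj₂ e₁)) (inj₁ e₂) (inj₂ (inj₁ e₃)) =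
          fifth-xy (from (swap e₃ ∸ e₂ ∸ e₂ ∸ e₁ ∸ e₁ ∸ e₁))
        scalene (inj₂ (inj₂ e₁)) (inj₁ e₂) (inj₂ (inj₂ e₃)) = y≢w (from (e₁ ∸ e₃))
        scalene (inj₂ (inj₂ e₁)) (inj₂ (inj₁ e₂)) (inj₁ e₃) =
          y≢p (from (swap (quarter-xy (from (swap e₃ ∸ e₃ ∸ e₂ ∸ e₁ ∸ e₁ ∸ e₁))) ∸ e₁))
        scalene (inj₂ (inj₂ e₁)) (inj₂ (inj₁ e₂)) (inj₂ (inj₁ e₃)) = x≢y (from (e₃ ∸ e₂))
        scalene (inj₂ (inj₂ e₁)) (inj₂ (inj₁ e₂)) (inj₂ (inj₂ e₃)) = y≢w (from (e₁ ∸ e₃))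
        scalene (inj₂ (inj₂ e₁)) (inj₂ (inj₂ e₂)) (inj₁ e₃) =
          fifth-xy (from (e₂ ∸ e₃ ∸ e₁ ∸ e₁ ∸ e₁))
        scalene (inj₂ (inj₂ e₁)) (inj₂ (inj₂ e₂)) (inj₂ (inj₁ e₃)) =
          no-heptagon f-resp f-refl fx fy fw x≉p y≉p w≉p x≉y y≉w x≉w
            (sym (holds e₁)) (sym (holds e₂)) (sym (holds e₃))
            (proj₂ (symmetric (x ∷ y ∷ w ∷ []) (Wx ∷ Wy ∷ Ww ∷ [])))
        scalene (inj₂ (inj₂ e₁)) (inj₂ (inj₂ e₂)) (inj₂ (inj₂ e₃)) = y≢w (from (e₁ ∸ e₃))

      -- Families closed under flips on `W`: no member has a rotation

      module _ {ℓᶠ} (Family : (Carrier → Bool) → Set ℓᶠ)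
        (respectful : ∀ {f} → Family f → Respectful f)
        (flip : ∀ {f B} → Family f → All W B → Family (f ⊞ B))
        (symmetric : ∀ {f} → Family f → ∃ (Reflection f) ⊎ ∃[ a ] ¬ a ≈ ε × Rotation f a)
        {p₀ p₁ p₂ p₃ : Carrier} (W₀ : W p₀) (W₁ : W p₁) (W₂ : W p₂) (W₃ : W p₃)
        (p₀≉p₁ : ¬ p₀ ≈ p₁) (p₀≉p₂ : ¬ p₀ ≈ p₂) (p₀≉p₃ : ¬ p₀ ≈ p₃)
        (p₁≉p₂ : ¬ p₁ ≈ p₂) (p₁≉p₃ : ¬ p₁ ≈ p₃) (p₂≉p₃ : ¬ p₂ ≈ p₃) where

        module _ {f} (f∈ : Family f) {a} (a≉ε : ¬ a ≈ ε) (fa : Rotation f a) where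

          private
            f-resp : Respectful f
            f-resp = respectful f∈

          -- Any symmetry of the flip at `x` gives `f` a change set of two entries, one of them `x`,
          -- with period `a`. If they differ, `a` carries `x` to the other one; by invariance under
          -- `a`, `f` then agrees at `x` and at its image, so `x` is no change. Only a reflection
          -- fixing `x` remains, and there the two entries cancel.
          flip-one⇒reflection : ∀ {x} → W x → Reflection f (x + x)
          flip-one⇒reflection {x} Wx = by-symmetry (symmetric (flip f∈ (Wx ∷ [])))
            where
            by-symmetry : ∃ (Reflection (f ⊞ (x ∷ []))) ⊎ ∃[ b ] ¬ b ≈ ε × Rotation (f ⊞ (x ∷ [])) b →
              Reflection f (x + x)
            by-symmetry (inj₁ (s , fs)) with (x + x) ≟ s
            ... | yes 2x≈s = reflection-cong f-resp (sym 2x≈s) (vanishing⇒reflection {f} {P = points (X ∷ S ⊖ X ∷ [])} changes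
                  (λ t → parity-cancel (X ∷ S ⊖ X ∷ []) 0F 0F (from 2x≐s) t))
              where
              open Partners (x ∷ s ∷ [])
              X S : Term 2
              X = var 0F
              S = var 1F
              2x≐s : ⊢ X ⊕ X ≐ S
              2x≐s = ⟨ 2x≈s ⟩
              changes : Reflects f s (points (X ∷ S ⊖ X ∷ []))
              changes = reflects {f} (x ∷ []) fs
            ... | no 2x≉s = ⊥-elim (by-parity (parity (points Q) x) ≡.refl)
              where
              open Partners (x ∷ s ∷ a ∷ [])
              X S A : Term 3
              X = var 0F
              S = var 1F
              A = var 2F
              Q : List (Term 3)
              Q = X ∷ S ⊖ X ∷ []
              changes : Reflects f s (points Q)
              changes = reflects {f} (x ∷ []) fs

              at-x : Any (λ T → ⊢ X ≐ T) (S ⊖ X ∷ []) → ⊥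
              at-x (here e) = 2x≉s (holds (from {e′ = X ⊕ X ≐ S} e))

              at-x+a : parity (points Q) x ≡ true → Any (λ T → ⊢ X ⊕ A ≐ T) Q → ⊥
              at-x+a odd (here e) = a≉ε (holds (from {e′ = A ≐ 𝟘} e))
              at-x+a odd (there (here ⟨ e ⟩)) = case ≡.trans (≡.sym odd) even of λ ()
                where
                even : parity (points Q) x ≡ false
                even = ≡.trans (≡.sym (changes x))
                  (≡.trans (≡.cong (f x xor_) (≡.trans (f-resp (sym e)) (fa x))) (xor-same (f x)))

              by-parity : ∀ b → parity (points Q) x ≡ b → ⊥
              by-parity false even = at-x (even-partner (S ⊖ X ∷ []) X even)
              by-parity true odd = at-x+a odd (odd⇒Any Q (X ⊕ A)
                (≡.trans (reflects-periodic {P = points Q} f-resp fa changes x) odd))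
            by-symmetry (inj₂ (b , b≉ε , fb)) = ⊥-elim (by-parity (parity (points Q) x) ≡.refl)
              where
              open Partners (x ∷ b ∷ a ∷ [])
              X B A : Term 3
              X = var 0F
              B = var 1F
              A = var 2F
              Q : List (Term 3)
              Q = X ∷ X ⊖ B ∷ []
              changes : Translates f b (points Q)
              changes = translates-flip {f} (x ∷ []) fb

              at-x : Any (λ T → ⊢ X ≐ T) (X ⊖ B ∷ []) → ⊥
              at-x (here e) = b≉ε (holds (from {e′ = B ≐ 𝟘} e))

              at-x+a : parity (points Q) x ≡ true → Any (λ T → ⊢ X ⊕ A ≐ T) Q → ⊥
              at-x+a odd (here e) = a≉ε (holds (from {e′ = A ≐ 𝟘} e))
              at-x+a odd (there (here e)) = case ≡.trans (≡.sym odd) even of λ ()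
                where
                back : ⊢ X ⊕ B ⊕ A ≐ X
                back = from e
                even : parity (points Q) x ≡ false
                even = ≡.trans (≡.sym (changes x))
                  (≡.trans (≡.cong (f x xor_) (≡.trans (≡.sym (fa (x + b))) (f-resp (holds back)))) (xor-same (f x)))

              by-parity : ∀ b → parity (points Q) x ≡ b → ⊥
              by-parity false even = at-x (even-partner (X ⊖ B ∷ []) X even)
              by-parity true odd = at-x+a odd (odd⇒Any Q (X ⊕ A)
                (≡.trans (translates-periodic {P = points Q} f-resp fa changes x) odd))

        family-reflection : ∀ {f} → Family f → ∃ (Reflection f)
        family-reflection f∈ with symmetric f∈
        ... | inj₁ reflection = reflection
        ... | inj₂ (a , a≉ε , fa) = p₀ + p₀ , flip-one⇒reflection f∈ a≉ε fa W₀

        module _ {f} (f∈ : Family f) {a} (a≉ε : ¬ a ≈ ε) (fa : Rotation f a) where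

          private
            f-resp : Respectful f
            f-resp = respectful f∈

            reflection-at : ∀ {x} → W x → Reflection f (x + x)
            reflection-at = flip-one⇒reflection f∈ a≉ε fa

          -- The axis `z` of the flip at `x` and `y` turns out to be an axis of `f` itself. It
          -- therefore preserves the pair, either exchanging its points or fixing both.
          reflection-or-antipodal : ∀ {x y} → W x → W y → ¬ x ≈ y →
            Reflection f (x + y) ⊎ x + x ≈ y + y
          reflection-or-antipodal {x} {y} Wx Wy x≉y = conclude fixes
            where
            z : Carrier
            z = proj₁ (family-reflection (flip f∈ (Wx ∷ Wy ∷ [])))

            changes : Reflects f z (x ∷ y ∷ z - x ∷ z - y ∷ [])
            changes = reflects {f} (x ∷ y ∷ []) (proj₂ (family-reflection (flip f∈ (Wx ∷ Wy ∷ []))))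

            module Turned (odd : parity (x ∷ y ∷ z - x ∷ z - y ∷ []) x ≡ true) {w} (Ww : W w) where
              open Partners (x ∷ y ∷ z ∷ w ∷ [])
              X Y Z V : Term 4
              X = var 0F
              Y = var 1F
              Z = var 2F
              V = var 3F
              Q : List (Term 4)
              Q = X ∷ Y ∷ Z ⊖ X ∷ Z ⊖ Y ∷ []

              rotated : ∀ T → Rotation f ⟦ T ⟧ → Any (λ S → ⊢ X ⊕ T ≐ S) Q
              rotated T fT = odd⇒Any Q (X ⊕ T)
                (≡.trans (reflects-periodic {P = points Q} f-resp fT changes x) odd)

              fixes-by : ⊢ V ⊕ V ≐ Z → Reflection f z
              fixes-by ⟨ e ⟩ = reflection-cong f-resp e (reflection-at Ww)

              fixes-by-x : ⊢ X ⊕ X ≐ Z → Reflection f z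
              fixes-by-x ⟨ e ⟩ = reflection-cong f-resp e (reflection-at Wx)

              quartered : ⊢ (V ⊕ V) ⊕ (V ⊕ V) ≐ (X ⊕ X) ⊕ (X ⊕ X) → Reflection f z ⊎ w + w ≈ x + x
              quartered ⟨ e ⟩ = inj₂ (quarter Ww Wx e)

              -- Products of the reflections in `w` and `x` translate by twice `w - x` in either
              -- direction, so both translates of the odd entry `X` occur in `Q`. If both equal `Y`,
              -- or both `Z ⊖ Y`, then `4w = 4x` and `quarter` applies; if they equal one each,
              -- adding gives `2x = z`.
              K⁺ K⁻ : Term 4
              K⁺ = (V ⊕ V) ⊖ (X ⊕ X)
              K⁻ = (X ⊕ X) ⊖ (V ⊕ V)

              compare : Any (λ S → ⊢ X ⊕ K⁺ ≐ S) Q → Any (λ S → ⊢ X ⊕ K⁻ ≐ S) Q →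
                Reflection f z ⊎ w + w ≈ x + x
              compare (here e) _ = inj₂ (holds (from {e′ = V ⊕ V ≐ X ⊕ X} e))
              compare _ (here e) = inj₂ (holds (from {e′ = V ⊕ V ≐ X ⊕ X} (swap e)))
              compare (there (there (here e))) _ = inj₁ (fixes-by (from e))
              compare _ (there (there (here e))) = inj₁ (reflection-cong f-resp
                (holds (from {e′ = X ⊕ X ⊕ K⁻ ≐ Z} e))
                (rotation∘reflection f-resp (reflection-at Wx)
                  (reflection∘reflection f-resp (reflection-at Wx) (reflection-at Ww))))
              compare (there (here e)) (there (here e′)) = quartered (from (e ∸ e′))
              compare (there (here e)) (there (there (there (here e′)))) = inj₁ (fixes-by-x (from (e ⊹ e′)))
              compare (there (there (there (here e)))) (there (here e′)) = inj₁ (fixes-by-x (from (e ⊹ e′)))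
              compare (there (there (there (here e)))) (there (there (there (here e′)))) =
                quartered (from (e ∸ e′))

              fixes-or-antipodal : Reflection f z ⊎ w + w ≈ x + x
              fixes-or-antipodal = compare
                (rotated K⁺ (reflection∘reflection f-resp (reflection-at Ww) (reflection-at Wx)))
                (rotated K⁻ (reflection∘reflection f-resp (reflection-at Wx) (reflection-at Ww)))

            fixes-if-odd : parity (x ∷ y ∷ z - x ∷ z - y ∷ []) x ≡ true → Reflection f z
            fixes-if-odd odd = all-antipodal (Turned.fixes-or-antipodal odd W₀) (Turned.fixes-or-antipodal odd W₁)
              (Turned.fixes-or-antipodal odd W₂)
              where
              all-antipodal : Reflection f z ⊎ p₀ + p₀ ≈ x + x → Reflection f z ⊎ p₁ + p₁ ≈ x + x →
                Reflection f z ⊎ p₂ + p₂ ≈ x + x → Reflection f z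
              all-antipodal (inj₁ fz) _ _ = fz
              all-antipodal _ (inj₁ fz) _ = fz
              all-antipodal _ _ (inj₁ fz) = fz
              all-antipodal (inj₂ e₀) (inj₂ e₁) (inj₂ e₂) = ⊥-elim
                (double-injective (trans e₀ (sym e₁)) (trans e₀ (sym e₂)) p₀≉p₁ p₀≉p₂ p₁≉p₂)

            open Partners (x ∷ y ∷ z ∷ [])
            X Y Z : Term 3
            X = var 0F
            Y = var 1F
            Z = var 2F
            Q : List (Term 3)
            Q = X ∷ Y ∷ Z ⊖ X ∷ Z ⊖ Y ∷ []

            fixes-if-even : Any (λ T → ⊢ X ≐ T) (Y ∷ Z ⊖ X ∷ Z ⊖ Y ∷ []) → Reflection f z
            fixes-if-even (here e) = ⊥-elim (x≉y (holds e))
            fixes-if-even (there (here e)) =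
              reflection-cong f-resp (holds (from {e′ = X ⊕ X ≐ Z} e)) (reflection-at Wx)
            fixes-if-even (there (there (here e))) = vanishing⇒reflection {f} {P = points Q} changes
              λ t → ≡.trans (parity-cancel Q 0F 2F e t)
                (parity-cancel (Y ∷ Z ⊖ X ∷ []) 0F 0F (from e) t)

            fixes : Reflection f z
            fixes = by-parity (parity (points Q) x) ≡.refl
              where
              by-parity : ∀ b → parity (points Q) x ≡ b → Reflection f z
              by-parity false even = fixes-if-even (even-partner (Y ∷ Z ⊖ X ∷ Z ⊖ Y ∷ []) X even)
              by-parity true odd = fixes-if-odd odd

            conclude : Reflection f z → Reflection f (x + y) ⊎ x + x ≈ y + y
            conclude fz = by-partner (partner Q 0F even)
              where
              even : Vanishing (points Q)
              even = reflection⇒vanishing {f} {P = points Q} changes fz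

              by-partner : Any (λ T → ⊢ X ≐ T) (Y ∷ Z ⊖ X ∷ Z ⊖ Y ∷ []) → _
              by-partner (here e) = ⊥-elim (x≉y (holds e))
              by-partner (there (here e)) = inj₂ (holds (from {e′ = X ⊕ X ≐ Y ⊕ Y}
                (e ∸ partner-of-two Y (Z ⊖ Y) (cancel Q 0F 1F e even))))
              by-partner (there (there (here e))) =
                inj₁ (reflection-cong f-resp (holds (from {e′ = Z ≐ X ⊕ Y} (swap e))) fz)

          difference : ∀ {x y} → W x → W y → ¬ x ≈ y → Rotation f (x - y) ⊎ x + x ≈ y + y
          difference {x} {y} Wx Wy x≉y = Sum.map₁ rotate (reflection-or-antipodal Wx Wy x≉y)
            where
            open In (x ∷ y ∷ [])
            X Y : Term 2
            X = var 0F
            Y = var 1F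
            shift : ⊢ X ⊕ Y ⊖ (Y ⊕ Y) ≐ X ⊖ Y
            shift = identity-law
            rotate : Reflection f (x + y) → Rotation f (x - y)
            rotate fx+y = rotation-cong f-resp (holds shift)
              (reflection∘reflection f-resp fx+y (reflection-at Wy))

          not-antipodal : ∀ x → ∃[ y ] W y × ¬ x + x ≈ y + y
          not-antipodal x = choose ((x + x) ≟ (p₀ + p₀)) ((x + x) ≟ (p₁ + p₁)) ((x + x) ≟ (p₂ + p₂))
            where
            choose : Dec (x + x ≈ p₀ + p₀) → Dec (x + x ≈ p₁ + p₁) → Dec (x + x ≈ p₂ + p₂) →
              ∃[ y ] W y × ¬ x + x ≈ y + y
            choose (no ≉₀) _ _ = p₀ , W₀ , ≉₀
            choose _ (no ≉₁) _ = p₁ , W₁ , ≉₁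
            choose _ _ (no ≉₂) = p₂ , W₂ , ≉₂
            choose (yes e₀) (yes e₁) (yes e₂) = ⊥-elim
              (double-injective (trans (sym e₀) e₁) (trans (sym e₀) e₂) p₀≉p₁ p₀≉p₂ p₁≉p₂)

          -- Two antipodal points, about which `difference` is silent, are joined through a third
          -- point of `W` with another double.
          difference-rotation : ∀ {x y} → W x → W y → ¬ x ≈ y → Rotation f (x - y)
          difference-rotation {x} {y} Wx Wy x≉y = connect (difference Wx Wy x≉y)
            where
            via : ∀ {w} → x + x ≈ y + y → ¬ x + x ≈ w + w →
              Rotation f (x - w) ⊎ x + x ≈ w + w → Rotation f (w - y) ⊎ w + w ≈ y + y → Rotation f (x - y)
            via 2x≈2y 2x≉2w (inj₂ e) _ = ⊥-elim (2x≉2w e)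
            via 2x≈2y 2x≉2w _ (inj₂ e) = ⊥-elim (2x≉2w (trans 2x≈2y (sym e)))
            via {w} 2x≈2y 2x≉2w (inj₁ fx-w) (inj₁ fw-y) =
              rotation-cong f-resp (holds shift) (rotation∘rotation f-resp fx-w fw-y)
              where
              open In (x ∷ y ∷ w ∷ [])
              X Y V : Term 3
              X = var 0F
              Y = var 1F
              V = var 2F
              shift : ⊢ (X ⊖ V) ⊕ (V ⊖ Y) ≐ X ⊖ Y
              shift = identity-law

            connect : Rotation f (x - y) ⊎ x + x ≈ y + y → Rotation f (x - y)
            connect (inj₁ fx-y) = fx-y
            connect (inj₂ 2x≈2y) with not-antipodal x
            ... | w , Ww , 2x≉2w = via 2x≈2y 2x≉2w
              (difference Wx Ww (λ e → 2x≉2w (∙-cong e e)))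
              (difference Ww Wy (λ e → 2x≉2w (trans 2x≈2y (sym (∙-cong e e)))))

          rotation-absurd : ⊥
          rotation-absurd = no-concentric f-resp (reflection-at W₀)
            (difference-rotation W₁ W₀ p₁≉p₀) (difference-rotation W₂ W₀ p₂≉p₀) (difference-rotation W₃ W₀ p₃≉p₀)
            W₁ W₂ W₃ p₁≉p₀ p₂≉p₀ p₃≉p₀ p₁≉p₂ p₂≉p₃ p₁≉p₃
            (λ B WB → family-reflection (flip f∈ (W₀ ∷ WB)))
            where
            p₁≉p₀ : ¬ p₁ ≈ p₀
            p₁≉p₀ e = p₀≉p₁ (sym e)
            p₂≉p₀ : ¬ p₂ ≈ p₀
            p₂≉p₀ e = p₀≉p₂ (sym e)
            p₃≉p₀ : ¬ p₃ ≈ p₀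
            p₃≉p₀ e = p₀≉p₃ (sym e)

        no-rotation : ∀ {f a} → Family f → Rotation f a → a ≈ ε
        no-rotation {a = a} f∈ fa = decidable-stable (a ≟ ε) λ a≉ε → rotation-absurd f∈ a≉ε fa

        -- Colorings with a single axis, and how flips move it

        module _ {f s x u} (f∈ : Family f) (fs : Reflection f s) (fu : Reflection (f ⊞ (x ∷ [])) u)
          (2x≉s : ¬ x + x ≈ s) where

          private
            open Partners (s ∷ x ∷ u ∷ [])
            S X U : Term 3
            S = var 0F
            X = var 1F
            U = var 2F

            changes : Reflects f u (points (X ∷ U ⊖ X ∷ []))
            changes = reflects {f} (x ∷ []) fu

          -- If the axis stayed, the flipped point would have to be its own mirror image.
          axis-moves : ¬ u ≈ s
          axis-moves u≈s = 2x≉s (trans (holds 2x≐u) u≈s)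
            where
            2x≐u : ⊢ X ⊕ X ≐ U
            2x≐u = from (partner-of-two X (U ⊖ X) (reflection⇒vanishing {f} {P = points (X ∷ U ⊖ X ∷ [])}
              changes (reflection-cong (respectful f∈) (sym u≈s) fs)))

          -- Flipping a point on the new axis back preserves that axis, so `f` would have two axes
          -- and hence a rotation.
          not-fixed : ¬ x + x ≈ u
          not-fixed 2x≈u = axis-moves (sym (holds s≐u))
            where
            2x≐u : ⊢ X ⊕ X ≐ U
            2x≐u = ⟨ 2x≈u ⟩
            fu′ : Reflection f u
            fu′ = vanishing⇒reflection {f} {P = points (X ∷ U ⊖ X ∷ [])} changes
              (parity-cancel (X ∷ U ⊖ X ∷ []) 0F 0F (from 2x≐u))
            s-u≐0 : ⊢ S ⊖ U ≐ 𝟘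
            s-u≐0 = ⟨ no-rotation f∈ (reflection∘reflection (respectful f∈) fs fu′) ⟩
            s≐u : ⊢ S ≐ U
            s≐u = from s-u≐0

        -- The axes s, u, v of f and of the colorings obtained by flipping x and y: after a
        -- translation making s = 0, either u = v, or u = −v, or f with one further point flipped
        -- is invariant under translation by both u and v.
        data Axes (s x u y v : Carrier) : Set ℓ where
          same : u ≈ v → x + y ≈ u → Axes s x u y v
          opposite : ¬ u ≈ v → u + v ≈ s + s → x + s ≈ y + u ⊎ x + y ≈ s → Axes s x u y v
          concentric : ¬ u ≈ v → ¬ u + v ≈ s + s → u - x ≈ v - y → (u - x) + (u - x) ≈ s →
            Axes s x u y v

        -- The translations by `s - u` and `s - v` change `f` at two listed points each. When they
        -- are equal or inverse, the two pairs are compared directly. Otherwise they are composed in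
        -- both orders, and since translations commute, the resulting four and four points must
        -- cancel.
        axes : ∀ {f s x u y v} → Family f → Reflection f s → Reflection (f ⊞ (x ∷ [])) u →
          Reflection (f ⊞ (y ∷ [])) v → ¬ x ≈ y → ¬ x + x ≈ s → ¬ y + y ≈ s → Axes s x u y v
        axes {f} {s} {x} {u} {y} {v} f∈ fs fu fv x≉y 2x≉s 2y≉s = classify (u ≟ v) ((u + v) ≟ (s + s))
          where
          open Partners (s ∷ x ∷ u ∷ y ∷ v ∷ [])
          S X U Y V : Term 5
          S = var 0F
          X = var 1F
          U = var 2F
          Y = var 3F
          V = var 4F

          f-resp : Respectful f
          f-resp = respectful f∈

          x≢y : ¬ (⊢ X ≐ Y)
          x≢y e = x≉y (holds e)
          2x≢s : ¬ (⊢ X ⊕ X ≐ S)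
          2x≢s e = 2x≉s (holds e)
          2y≢s : ¬ (⊢ Y ⊕ Y ≐ S)
          2y≢s e = 2y≉s (holds e)
          u≢s : ¬ (⊢ U ≐ S)
          u≢s e = axis-moves f∈ fs fu 2x≉s (holds e)
          v≢s : ¬ (⊢ V ≐ S)
          v≢s e = axis-moves f∈ fs fv 2y≉s (holds e)
          2x≢u : ¬ (⊢ X ⊕ X ≐ U)
          2x≢u e = not-fixed f∈ fs fu 2x≉s (holds e)
          2y≢v : ¬ (⊢ Y ⊕ Y ≐ V)
          2y≢v e = not-fixed f∈ fs fv 2y≉s (holds e)

          -- A prime is the mirror image in the point's own new axis, `u` or `v`. A star is the
          -- mirror image under `T ↦ u + v − s − T`, which exchanges the four points of one order of
          -- composition with those of the other.
          X* X′ X′* Y* Y′ Y′* : Term 5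
          X* = (U ⊖ X) ⊖ (S ⊖ V)
          X′ = U ⊖ X
          X′* = X ⊖ (S ⊖ V)
          Y* = (V ⊖ Y) ⊖ (S ⊖ U)
          Y′ = V ⊖ Y
          Y′* = Y ⊖ (S ⊖ U)

          x-changes : Translates f (s - u) (points (X ∷ X′ ∷ []))
          x-changes = translates {f} {P = points (X ∷ X′ ∷ [])} f-resp fs (reflects {f} (x ∷ []) fu)

          y-changes : Translates f (s - v) (points (Y ∷ Y′ ∷ []))
          y-changes = translates {f} {P = points (Y ∷ Y′ ∷ [])} f-resp fs (reflects {f} (y ∷ []) fv)

          if-same : u ≈ v → Axes s x u y v
          if-same u≈v = by-partner (partner (X ∷ X′ ∷ Y ∷ Y′ ∷ []) 0F
            (translates-unique {P = points (X ∷ X′ ∷ [])} {Q = points (Y ∷ Y′ ∷ [])} f-resp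
              (∙-congˡ (⁻¹-cong u≈v)) x-changes y-changes))
            where
            u≐v : ⊢ U ≐ V
            u≐v = ⟨ u≈v ⟩
            by-partner : Any (λ T → ⊢ X ≐ T) (X′ ∷ Y ∷ Y′ ∷ []) → Axes s x u y v
            by-partner (here e) = ⊥-elim (2x≢u (from e))
            by-partner (there (here e)) = ⊥-elim (x≢y e)
            by-partner (there (there (here e))) = same u≈v (holds (from {e′ = X ⊕ Y ≐ U} (e ∸ u≐v)))

          if-opposite : ¬ u ≈ v → u + v ≈ s + s → Axes s x u y v
          if-opposite u≉v u+v≈2s = by-partner (partner (X ∷ X′ ∷ Y′* ∷ Y* ∷ []) 0F
            (translates-unique {P = points (X ∷ X′ ∷ [])} {Q = points (Y′* ∷ Y* ∷ [])} f-resp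
              refl x-changes y-changes′))
            where
            u+v≐2s : ⊢ U ⊕ V ≐ S ⊕ S
            u+v≐2s = ⟨ u+v≈2s ⟩
            undo : ⊢ (S ⊖ U) ⊕ (S ⊖ V) ≐ 𝟘
            undo = from (swap u+v≐2s)
            y-changes′ : Translates f (s - u) (points (Y′* ∷ Y* ∷ []))
            y-changes′ = translates-inverse {P = points (Y ∷ Y′ ∷ [])} f-resp
              (λ t → trans (assoc t _ _) (trans (∙-congˡ (holds undo)) (identityʳ t))) y-changes
            by-partner : Any (λ T → ⊢ X ≐ T) (X′ ∷ Y′* ∷ Y* ∷ []) → Axes s x u y v
            by-partner (here e) = ⊥-elim (2x≢u (from e))
            by-partner (there (here e)) =
              opposite u≉v u+v≈2s (inj₁ (holds (from {e′ = X ⊕ S ≐ Y ⊕ U} e)))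
            by-partner (there (there (here e))) =
              opposite u≉v u+v≈2s (inj₂ (holds (from {e′ = X ⊕ Y ≐ S} (e ⊹ u+v≐2s))))

          module General (u≉v : ¬ u ≈ v) (u+v≉2s : ¬ u + v ≈ s + s) where

            u≢v : ¬ (⊢ U ≐ V)
            u≢v e = u≉v (holds e)
            u+v≢2s : ¬ (⊢ U ⊕ V ≐ S ⊕ S)
            u+v≢2s e = u+v≉2s (holds e)

            Q : List (Term 5)
            Q = X ∷ X′ ∷ Y′* ∷ Y* ∷ Y ∷ Y′ ∷ X′* ∷ X* ∷ []

            even : Vanishing (points Q)
            even = translates-unique {P = points (X ∷ X′ ∷ Y′* ∷ Y* ∷ [])} {Q = points (Y ∷ Y′ ∷ X′* ∷ X* ∷ [])}
              f-resp (comm _ _)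
              (translates-+ {P = points (X ∷ X′ ∷ [])} {Q = points (Y ∷ Y′ ∷ [])} f-resp x-changes y-changes)
              (translates-+ {P = points (Y ∷ Y′ ∷ [])} {Q = points (X ∷ X′ ∷ [])} f-resp y-changes x-changes)

            half-turn : ∀ P M N O R R′ → Translates f ⟦ R ⟧ (points (P ∷ M ∷ [])) →
              Translates f ⟦ R′ ⟧ (points (N ∷ O ∷ [])) →
              ⊢ M ≐ O ⊖ R → ⊢ N ⊖ R ≐ P ⊕ (R ⊕ R′) → ⊢ P ⊕ P ⊕ (R ⊕ R′) ≐ S →
              ¬ (⊢ R ⊕ R′ ≐ 𝟘) → ⊥
            half-turn P M N O R R′ fr fr′ e₁ e₂ e₃ a≢0 =
              a≢0 ⟨ half-turn-trivial f-resp fs fr fr′ (holds e₁) (holds e₂) (holds e₃) ⟩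

            x-changes′ : Translates f (s - u) (points (X′ ∷ X ∷ []))
            x-changes′ = translates-swap {f} x-changes
            y-changes′ : Translates f (s - v) (points (Y′ ∷ Y ∷ []))
            y-changes′ = translates-swap {f} y-changes
            -- With the second translation inverted the total becomes `v - u`, nonzero as the axes
            -- differ; the total of the original two is nonzero as they are not opposite.
            -- `half-turn` is applied to both.
            y-changes⁻ : Translates f (v - s) (points (Y ⊖ (V ⊖ S) ∷ Y′ ⊖ (V ⊖ S) ∷ []))
            y-changes⁻ = translates-inverse {P = points (Y ∷ Y′ ∷ [])} f-resp
              (λ t → trans (assoc t _ _) (trans (∙-congˡ (holds undo)) (identityʳ t))) y-changes
              where
              undo : ⊢ (V ⊖ S) ⊕ (S ⊖ V) ≐ 𝟘
              undo = identity-law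
            y-changes⁻′ : Translates f (v - s) (points (Y′ ⊖ (V ⊖ S) ∷ Y ⊖ (V ⊖ S) ∷ []))
            y-changes⁻′ = translates-swap {f} y-changes⁻

            sum≢0 : ¬ (⊢ (S ⊖ U) ⊕ (S ⊖ V) ≐ 𝟘)
            sum≢0 e = u+v≢2s (from (swap e))
            difference≢0 : ¬ (⊢ (S ⊖ U) ⊕ (V ⊖ S) ≐ 𝟘)
            difference≢0 e = u≢v (from (swap e))

            -- The eight points of Q come in four pairs {T, u + v − s − T}; two points of Q can
            -- only agree together with their companions.
            x=y* : ⊢ X ≐ Y* → Axes s x u y v
            x=y* d = by-partner (partner (X′ ∷ Y′* ∷ Y′ ∷ X′* ∷ []) 0F rest)
              where
              rest : Vanishing (points (X′ ∷ Y′* ∷ Y′ ∷ X′* ∷ []))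
              rest = cancel (X′ ∷ Y′* ∷ Y ∷ Y′ ∷ X′* ∷ X* ∷ []) 2F 4F (from d) (cancel Q 0F 2F d even)
              by-partner : Any (λ T → ⊢ X′ ≐ T) (Y′* ∷ Y′ ∷ X′* ∷ []) → Axes s x u y v
              by-partner (here g) = ⊥-elim (u+v≢2s (from (swap (d ⊹ g))))
              by-partner (there (here h)) = concentric u≉v u+v≉2s (holds h)
                (holds (from {e′ = X′ ⊕ X′ ≐ S} (h ∸ d)))
              by-partner (there (there (here e))) = ⊥-elim
                (half-turn X′ X Y Y′ (S ⊖ U) (S ⊖ V) x-changes′ y-changes (from d)
                  (from (swap e′ ∸ e ∸ d)) (from e) sum≢0)
                where
                e′ : ⊢ Y′ ≐ Y′*
                e′ = swap (partner-of-two Y′* Y′ (cancel (X′ ∷ Y′* ∷ Y′ ∷ X′* ∷ []) 0F 2F e rest))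

            x=y′ : ⊢ X ≐ Y′ → ⊥
            x=y′ b = by-partner (partner (X′ ∷ Y* ∷ Y ∷ X′* ∷ []) 0F rest)
              where
              rest : Vanishing (points (X′ ∷ Y* ∷ Y ∷ X′* ∷ []))
              rest = cancel (X′ ∷ Y′* ∷ Y* ∷ Y ∷ X′* ∷ X* ∷ []) 1F 4F (from b) (cancel Q 0F 4F b even)
              by-partner : Any (λ T → ⊢ X′ ≐ T) (Y* ∷ Y ∷ X′* ∷ []) → ⊥
              by-partner (here c) = 2x≢s (from (b ∸ c))
              by-partner (there (here c)) = u≢v (from (b ⊹ c))
              by-partner (there (there (here e))) =
                half-turn X X′ (Y′ ⊖ (V ⊖ S)) (Y ⊖ (V ⊖ S)) (S ⊖ U) (V ⊖ S) x-changes y-changes⁻′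
                  (from (swap b)) (from (e ⊹ b ∸ a)) (from (swap e)) difference≢0
                where
                a : ⊢ Y ≐ Y*
                a = swap (partner-of-two Y* Y (cancel (X′ ∷ Y* ∷ Y ∷ X′* ∷ []) 0F 2F e rest))

            x=y′* : ⊢ X ≐ Y′* → ⊥
            x=y′* c = by-partner (partner (X′ ∷ Y* ∷ Y ∷ X′* ∷ []) 0F rest)
              where
              rest : Vanishing (points (X′ ∷ Y* ∷ Y ∷ X′* ∷ []))
              rest = cancel (X′ ∷ Y* ∷ Y ∷ Y′ ∷ X′* ∷ X* ∷ []) 3F 4F (from c) (cancel Q 0F 1F c even)
              by-partner : Any (λ T → ⊢ X′ ≐ T) (Y* ∷ Y ∷ X′* ∷ []) → ⊥
              by-partner (here c′) = u+v≢2s (from (swap (c ⊹ c′)))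
              by-partner (there (here b)) = 2y≢s (from (swap (c ⊹ b)))
              by-partner (there (there (here e))) =
                half-turn X′ X Y′ Y (S ⊖ U) (S ⊖ V) x-changes′ y-changes′
                  (from c) (from (swap a ∸ e ∸ c)) (from e) sum≢0
                where
                a : ⊢ Y ≐ Y*
                a = swap (partner-of-two Y* Y (cancel (X′ ∷ Y* ∷ Y ∷ X′* ∷ []) 0F 2F e rest))

            x=x* : ⊢ X ≐ X* → ⊥
            x=x* a = by-partner (partner Q′ 0F rest)
              where
              Q′ : List (Term 5)
              Q′ = X′ ∷ Y′* ∷ Y* ∷ Y ∷ Y′ ∷ X′* ∷ []
              rest : Vanishing (points Q′)
              rest = cancel Q 0F 6F a even
              by-partner : Any (λ T → ⊢ X′ ≐ T) (Y′* ∷ Y* ∷ Y ∷ Y′ ∷ X′* ∷ []) → ⊥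
              by-partner (here g) =
                half-turn X X′ Y′ Y (S ⊖ U) (S ⊖ V) x-changes y-changes′
                  (from g) (from (swap a′ ∸ g ∸ a)) (from a) sum≢0
                where
                a′ : ⊢ Y ≐ Y*
                a′ = swap (partner-of-two Y* Y
                  (cancel (Y* ∷ Y ∷ Y′ ∷ X′* ∷ []) 2F 2F (from g) (cancel Q′ 0F 0F g rest)))
              by-partner (there (here c)) =
                half-turn X X′ Y Y′ (S ⊖ U) (S ⊖ V) x-changes y-changes
                  (from c) (from (swap e′ ∸ c ∸ a)) (from a) sum≢0
                where
                e′ : ⊢ Y′ ≐ Y′*
                e′ = swap (partner-of-two Y′* Y′
                  (cancel (Y′* ∷ Y ∷ Y′ ∷ X′* ∷ []) 1F 2F (from c) (cancel Q′ 0F 1F c rest)))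
              by-partner (there (there (here b))) =
                half-turn X′ X (Y ⊖ (V ⊖ S)) (Y′ ⊖ (V ⊖ S)) (S ⊖ U) (V ⊖ S) x-changes′ y-changes⁻
                  (from (swap b)) (from (a ⊹ b ∸ e′)) (from (swap a)) difference≢0
                where
                e′ : ⊢ Y′ ≐ Y′*
                e′ = swap (partner-of-two Y′* Y′
                  (cancel (Y′* ∷ Y* ∷ Y′ ∷ X′* ∷ []) 1F 2F (from b) (cancel Q′ 0F 2F b rest)))
              by-partner (there (there (there (here h)))) =
                half-turn X′ X (Y′ ⊖ (V ⊖ S)) (Y ⊖ (V ⊖ S)) (S ⊖ U) (V ⊖ S) x-changes′ y-changes⁻′
                  (from (swap h)) (from (h ⊹ a ∸ a′)) (from (swap a)) difference≢0
                where
                a′ : ⊢ Y ≐ Y*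
                a′ = swap (partner-of-two Y* Y
                  (cancel (Y′* ∷ Y* ∷ Y ∷ X′* ∷ []) 0F 2F (from h) (cancel Q′ 0F 3F h rest)))
              by-partner (there (there (there (there (here e))))) =
                y-partner (partner (Y′* ∷ Y* ∷ Y ∷ Y′ ∷ []) 2F rest′)
                where
                rest′ : Vanishing (points (Y′* ∷ Y* ∷ Y ∷ Y′ ∷ []))
                rest′ = cancel Q′ 0F 4F e rest
                y-partner : Any (λ T → ⊢ Y ≐ T) (Y′* ∷ Y* ∷ Y′ ∷ []) → ⊥
                y-partner (here e′) = u≢s (from (swap e′))
                -- Here `s`, `u`, `v` would be three distinct elements with the same double.
                y-partner (there (here a′)) = double-injective
                  (holds (from {e′ = S ⊕ S ≐ U ⊕ U} (a′ ∸ partner-of-two Y′* Y′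
                    (cancel (Y′* ∷ Y* ∷ Y ∷ Y′ ∷ []) 2F 1F a′ rest′))))
                  (holds (from {e′ = S ⊕ S ≐ V ⊕ V} (a ⊹ e)))
                  (λ s≈u → u≢s ⟨ sym s≈u ⟩) (λ s≈v → v≢s ⟨ sym s≈v ⟩) u≉v
                y-partner (there (there (here e′))) = 2y≢v (from e′)

            result : Axes s x u y v
            result = by-partner (partner Q 0F even)
              where
              by-partner : Any (λ T → ⊢ X ≐ T) (X′ ∷ Y′* ∷ Y* ∷ Y ∷ Y′ ∷ X′* ∷ X* ∷ []) → Axes s x u y v
              by-partner (here e) = ⊥-elim (2x≢u (from e))
              by-partner (there (here e)) = ⊥-elim (x=y′* e)
              by-partner (there (there (here e))) = x=y* e
              by-partner (there (there (there (here e)))) = ⊥-elim (x≢y e)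
              by-partner (there (there (there (there (here e))))) = ⊥-elim (x=y′ e)
              by-partner (there (there (there (there (there (here e)))))) = ⊥-elim (v≢s (from (swap e)))
              by-partner (there (there (there (there (there (there (here e))))))) = ⊥-elim (x=x* e)

          classify : Dec (u ≈ v) → Dec (u + v ≈ s + s) → Axes s x u y v
          classify (yes u≈v) _ = if-same u≈v
          classify (no u≉v) (yes u+v≈2s) = if-opposite u≉v u+v≈2s
          classify (no u≉v) (no u+v≉2s) = General.result u≉v u+v≉2s

        -- The translation by `s - u` changes `f` at `x` and at `u - x`, which is `q`. Flipping `q`
        -- adds changes at `q` and at `q - (s - u)`, which is `x` because `2q = s`, and all four
        -- cancel.
        rotation-about : ∀ {f s x u q} → Family f → Reflection f s → Reflection (f ⊞ (x ∷ [])) u →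
          q ≈ u - x → q + q ≈ s → Rotation (f ⊞ (q ∷ [])) (x - q)
        rotation-about {f} {s} {x} {u} {q} f∈ fs fu q≈u-x 2q≈s =
          rotation-inverse (⊞-respectful f-resp (q ∷ [])) undo
            (vanishing⇒rotation {P = points P} changes even)
          where
          f-resp : Respectful f
          f-resp = respectful f∈
          open Partners (s ∷ x ∷ u ∷ q ∷ [])
          S X U Q : Term 4
          S = var 0F
          X = var 1F
          U = var 2F
          Q = var 3F
          P : List (Term 4)
          P = X ∷ U ⊖ X ∷ Q ∷ Q ⊖ (S ⊖ U) ∷ []
          q≐u-x : ⊢ Q ≐ U ⊖ X
          q≐u-x = ⟨ q≈u-x ⟩
          2q≐s : ⊢ Q ⊕ Q ≐ S
          2q≐s = ⟨ 2q≈s ⟩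
          changes : Translates (f ⊞ (q ∷ [])) (s - u) (points P)
          changes = translates-⊞ {f} {P = points (X ∷ U ⊖ X ∷ [])} (q ∷ [])
            (translates {f} {P = points (X ∷ U ⊖ X ∷ [])} f-resp fs (reflects {f} (x ∷ []) fu))
          even : Vanishing (points P)
          even t = ≡.trans (parity-cancel P 0F 2F (from (q≐u-x ∸ 2q≐s)) t)
            (parity-cancel (U ⊖ X ∷ Q ∷ []) 0F 0F (swap q≐u-x) t)
          unshift : ⊢ (X ⊖ Q) ⊕ (S ⊖ U) ≐ 𝟘
          unshift = from (q≐u-x ∸ 2q≐s)
          undo : ∀ t → t + (x - q) + (s - u) ≈ t
          undo t = trans (assoc t _ _) (trans (∙-congˡ (holds unshift)) (identityʳ t))

        -- Flipping `q = u - x` creates rotations by `x - q`, `y - q` and `z - q` about the axis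
        -- through `q`. As `q` may lie outside `W`, the new coloring need not belong to the family;
        -- but flipping `q` back together with points of `W` leads into it, which is what
        -- `no-concentric` asks for.
        not-concentric : ∀ {f s x u y v z} → Family f → Reflection f s → W x → W y → W z →
          Reflection (f ⊞ (x ∷ [])) u → Reflection (f ⊞ (y ∷ [])) v →
          ¬ x ≈ y → ¬ y ≈ z → ¬ x ≈ z → ¬ x + x ≈ s → ¬ y + y ≈ s → ¬ z + z ≈ s →
          ¬ u ≈ v → ¬ u + v ≈ s + s → u - x ≈ v - y → ¬ (u - x) + (u - x) ≈ s
        not-concentric {f} {s} {x} {u} {y} {v} {z} f∈ fs Wx Wy Wz fu fv x≉y y≉z x≉z 2x≉s 2y≉s 2z≉s
          u≉v u+v≉2s u-x≈v-y 2q≈s =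
          no-concentric e-resp e-refl
            (rotation-about f∈ fs fu refl 2q≈s)
            (rotation-about f∈ fs fv u-x≈v-y 2q≈s)
            (rotation-about f∈ fs ft third 2q≈s)
            Wx Wy Wz (apart 2x≉s) (apart 2y≉s) (apart 2z≉s) x≉y y≉z x≉z unflip
          where
          q t : Carrier
          q = u - x
          t = proj₁ (family-reflection (flip f∈ (Wz ∷ [])))
          ft : Reflection (f ⊞ (z ∷ [])) t
          ft = proj₂ (family-reflection (flip f∈ (Wz ∷ [])))

          e-resp : Respectful (f ⊞ (q ∷ []))
          e-resp = ⊞-respectful (respectful f∈) (q ∷ [])

          e-refl : Reflection (f ⊞ (q ∷ [])) (q + q)
          e-refl t = ≡.cong₂ _xor_ (reflection-cong (respectful f∈) (sym 2q≈s) fs t)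
            (≡.trans (parity-reflect (q + q) (q ∷ []) t)
              (≡.cong (_xor false) (δ-cong₂ (trans (sym (holds q-fixed))) (trans (holds q-fixed)))))
            where
            open In (q ∷ [])
            Q : Term 1
            Q = var 0F
            q-fixed : ⊢ Q ⊕ Q ⊖ Q ≐ Q
            q-fixed = identity-law

          apart : ∀ {w} → ¬ w + w ≈ s → ¬ w ≈ q
          apart 2w≉s w≈q = 2w≉s (trans (∙-cong w≈q w≈q) 2q≈s)

          unflip : ∀ B → All W B → ∃ (Reflection (f ⊞ (q ∷ []) ⊞ (q ∷ B)))
          unflip B WB with family-reflection (flip f∈ WB)
          ... | r , fr = r , reflection-ext (λ t → ≡.sym (⊞-self f q B t)) fr

          open In (s ∷ u ∷ v ∷ t ∷ [])
          S U V T : Term 4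
          S = var 0F
          U = var 1F
          V = var 2F
          T = var 3F
          u≢v : ¬ (⊢ U ≐ V)
          u≢v e = u≉v (holds e)
          u+v≢2s : ¬ (⊢ U ⊕ V ≐ S ⊕ S)
          u+v≢2s e = u+v≉2s (holds e)
          equal : ∀ {A B} → ⟦ A ⟧ ≈ ⟦ B ⟧ → ⊢ A ≐ B
          equal = ⟨_⟩

          via-y : Axes s y v z t → u ≈ t ⊎ u + t ≈ s + s → q ≈ t - z
          via-y (same v≈t _) (inj₁ u≈t) = ⊥-elim (u≉v (trans u≈t (sym v≈t)))
          via-y (same v≈t _) (inj₂ u+t≈2s) = ⊥-elim (u+v≉2s (trans (∙-congˡ v≈t) u+t≈2s))
          via-y (opposite _ v+t≈2s _) (inj₁ u≈t) =
            ⊥-elim (u+v≉2s (trans (comm u v) (trans (∙-congˡ u≈t) v+t≈2s)))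
          via-y (opposite _ v+t≈2s _) (inj₂ u+t≈2s) = ⊥-elim (u≢v
            (from (equal {U ⊕ T} {S ⊕ S} u+t≈2s ∸ equal {V ⊕ T} {S ⊕ S} v+t≈2s)))
          via-y (concentric _ _ v-y≈t-z _) _ = trans u-x≈v-y v-y≈t-z

          via-x : Axes s x u z t → Axes s y v z t → q ≈ t - z
          via-x (same u≈t _) yz = via-y yz (inj₁ u≈t)
          via-x (opposite _ u+t≈2s _) yz = via-y yz (inj₂ u+t≈2s)
          via-x (concentric _ _ u-x≈t-z _) _ = u-x≈t-z

          -- The axes `u` and `v` are neither equal nor opposite, so `t` cannot be equal or opposite
          -- to both; `z` is thus concentric with `x` or with `y`.
          third : q ≈ t - z
          third = via-x (axes f∈ fs fu ft x≉z 2x≉s 2z≉s) (axes f∈ fs fv ft y≉z 2y≉s 2z≉s)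

        -- After a translation making s = 0: the axes are u, u, −u, with x = z + u and y = −z.
        no-interval : ∀ {f s x u y z t} → Family f → Reflection f s → W x → W y → W z →
          Reflection (f ⊞ (x ∷ [])) u → ¬ x ≈ y → ¬ y ≈ z → ¬ x ≈ z →
          ¬ x + x ≈ s → ¬ u ≈ t → u + t ≈ s + s →
          x + y ≈ u → x + s ≈ z + u → ¬ y + z ≈ s
        no-interval {f} {s} {x} {u} {y} {z} {t} f∈ fs Wx Wy Wz fu x≉y y≉z x≉z 2x≉s u≉t u+t≈2s
          x+y≈u x+s≈z+u y+z≈s = by-double ((z + z) ≟ u)
          where
          f-resp : Respectful f
          f-resp = respectful f∈
          open Partners (s ∷ x ∷ u ∷ y ∷ z ∷ t ∷ [])
          S X U Y Z T : Term 6
          S = var 0F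
          X = var 1F
          U = var 2F
          Y = var 3F
          Z = var 4F
          T = var 5F
          x+y≐u : ⊢ X ⊕ Y ≐ U
          x+y≐u = ⟨ x+y≈u ⟩
          x+s≐z+u : ⊢ X ⊕ S ≐ Z ⊕ U
          x+s≐z+u = ⟨ x+s≈z+u ⟩
          y+z≐s : ⊢ Y ⊕ Z ≐ S
          y+z≐s = ⟨ y+z≈s ⟩
          u+t≐2s : ⊢ U ⊕ T ≐ S ⊕ S
          u+t≐2s = ⟨ u+t≈2s ⟩
          x≢y : ¬ (⊢ X ≐ Y)
          x≢y e = x≉y (holds e)
          y≢z : ¬ (⊢ Y ≐ Z)
          y≢z e = y≉z (holds e)
          u≢t : ¬ (⊢ U ≐ T)
          u≢t e = u≉t (holds e)

          -- For `s = 0` and `u = 2z` the points `y`, `z`, `x` are `-z`, `z`, `3z`, in steps of `u`.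
          -- Translation by `-u` changes `f` at the two ends, and flipping `y` and `z` removes
          -- exactly these changes.
          periodic : z + z ≈ u → Rotation (f ⊞ (y ∷ z ∷ [])) (s - u)
          periodic 2z≈u = vanishing⇒rotation {P = points P} changes even
            where
            2z≐u : ⊢ Z ⊕ Z ≐ U
            2z≐u = ⟨ 2z≈u ⟩
            P : List (Term 6)
            P = X ∷ U ⊖ X ∷ Y ∷ Z ∷ Y ⊖ (S ⊖ U) ∷ Z ⊖ (S ⊖ U) ∷ []
            changes : Translates (f ⊞ (y ∷ z ∷ [])) (s - u) (points P)
            changes = translates-⊞ {f} {P = points (X ∷ U ⊖ X ∷ [])} (y ∷ z ∷ [])
              (translates {f} {P = points (X ∷ U ⊖ X ∷ [])} f-resp fs (reflects {f} (x ∷ []) fu))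
            even : Vanishing (points P)
            even t = ≡.trans (parity-cancel P 0F 4F (from x+s≐z+u) t)
              (≡.trans (parity-cancel (U ⊖ X ∷ Y ∷ Z ∷ Y ⊖ (S ⊖ U) ∷ []) 0F 0F (from (swap x+y≐u)) t)
                (parity-cancel (Z ∷ Y ⊖ (S ⊖ U) ∷ []) 0F 0F (from (2z≐u ∸ y+z≐s)) t))

          -- When `2z` differs from `u`, the flip at `x` is taken as a new starting point: its axis
          -- is `u`, and flipping `x` again moves the axis to `s`. This move is compared with the
          -- one caused by `z`.
          g : Carrier → Bool
          g = f ⊞ (x ∷ [])
          g∈ : Family g
          g∈ = flip f∈ (Wx ∷ [])
          gs : Reflection (g ⊞ (x ∷ [])) s
          gs = reflection-ext (λ t → ≡.sym (≡.trans (⊞-self f x [] t) (xor-identityʳ (f t)))) fs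
          flipped : ∀ {w} → W w → ∃ (Reflection (g ⊞ (w ∷ [])))
          flipped Ww = family-reflection (flip g∈ (Ww ∷ []))

          2x≉u : ¬ x + x ≈ u
          2x≉u = not-fixed f∈ fs fu 2x≉s
          2y≉u : ¬ y + y ≈ u
          2y≉u 2y≈u = x≢y (from (x+y≐u ∸ 2y≐u))
            where
            2y≐u : ⊢ Y ⊕ Y ≐ U
            2y≐u = ⟨ 2y≈u ⟩

          by-axes : ∀ {r} → ¬ z + z ≈ u → Reflection (g ⊞ (z ∷ [])) r → Axes u x s z r → ⊥
          by-axes _ _ (same _ x+z≈s) = x≢y (from (x+z≐s ∸ y+z≐s))
            where
            x+z≐s : ⊢ X ⊕ Z ≐ S
            x+z≐s = ⟨ x+z≈s ⟩
          by-axes _ _ (opposite _ _ (inj₁ x+u≈z+s)) = u≢t (from (x+u≐z+s ∸ x+s≐z+u ∸ u+t≐2s))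
            where
            x+u≐z+s : ⊢ X ⊕ U ≐ Z ⊕ S
            x+u≐z+s = ⟨ x+u≈z+s ⟩
          by-axes _ _ (opposite _ _ (inj₂ x+z≈u)) = y≢z (from (x+y≐u ∸ x+z≐u))
            where
            x+z≐u : ⊢ X ⊕ Z ≐ U
            x+z≐u = ⟨ x+z≈u ⟩
          by-axes 2z≉u gr (concentric s≉r s+r≉2u s-x≈r-z 2q≈u) =
            not-concentric g∈ fu Wx Wz Wy gs gr x≉z (λ e → y≉z (sym e)) x≉y 2x≉u 2z≉u 2y≉u
              s≉r s+r≉2u s-x≈r-z 2q≈u

          by-double : Dec (z + z ≈ u) → ⊥
          by-double (yes 2z≈u) = axis-moves f∈ fs fu 2x≉s (holds (from {e′ = U ≐ S} (swap s-u≐0)))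
            where
            s-u≐0 : ⊢ S ⊖ U ≐ 𝟘
            s-u≐0 = ⟨ no-rotation (flip f∈ (Wy ∷ Wz ∷ [])) (periodic 2z≈u) ⟩
          by-double (no 2z≉u) = by-axes 2z≉u (proj₂ (flipped Wz))
            (axes g∈ fu gs (proj₂ (flipped Wz)) x≉z 2x≉u 2z≉u)

        -- With `x` and `y` sharing an axis, that of `z` must be opposite to it. Opposite axes come
        -- with one of two relations; the same relation for `x` and `y` makes them equal, and the
        -- mixed case is `no-interval`.
        no-three-same : ∀ {f s x u y v z t} → Family f → Reflection f s → W x → W y → W z →
          Reflection (f ⊞ (x ∷ [])) u → Reflection (f ⊞ (y ∷ [])) v → Reflection (f ⊞ (z ∷ [])) t →
          ¬ x ≈ y → ¬ y ≈ z → ¬ x ≈ z → ¬ x + x ≈ s → ¬ y + y ≈ s → ¬ z + z ≈ s →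
          u ≈ v → ¬ x + y ≈ u
        no-three-same {f} {s} {x} {u} {y} {v} {z} {t} f∈ fs Wx Wy Wz fu fv ft x≉y y≉z x≉z 2x≉s 2y≉s 2z≉s
          u≈v x+y≈u = by-axes (axes f∈ fs fu ft x≉z 2x≉s 2z≉s) (axes f∈ fs fv ft y≉z 2y≉s 2z≉s)
          where
          open In (s ∷ x ∷ u ∷ y ∷ v ∷ z ∷ [])
          S X U Y V Z : Term 6
          S = var 0F
          X = var 1F
          U = var 2F
          Y = var 3F
          V = var 4F
          Z = var 5F
          equal : ∀ A B → ⟦ A ⟧ ≈ ⟦ B ⟧ → ⊢ A ≐ B
          equal A B = ⟨_⟩
          u≐v : ⊢ U ≐ V
          u≐v = ⟨ u≈v ⟩
          x≢y : ¬ (⊢ X ≐ Y)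
          x≢y e = x≉y (holds e)

          by-axes : Axes s x u z t → Axes s y v z t → ⊥
          by-axes (same _ x+z≈u) _ = y≉z (holds (from {e′ = Y ≐ Z}
            (equal (X ⊕ Y) U x+y≈u ∸ equal (X ⊕ Z) U x+z≈u)))
          by-axes _ (same _ y+z≈v) = x≉z (holds (from {e′ = X ≐ Z}
            (equal (X ⊕ Y) U x+y≈u ∸ equal (Y ⊕ Z) V y+z≈v ⊹ u≐v)))
          by-axes (concentric u≉t u+t≉2s q 2q≈s) _ =
            not-concentric f∈ fs Wx Wz Wy fu ft x≉z (λ e → y≉z (sym e)) x≉y 2x≉s 2z≉s 2y≉s u≉t u+t≉2s q 2q≈s
          by-axes _ (concentric v≉t v+t≉2s q 2q≈s) =
            not-concentric f∈ fs Wy Wz Wx fv ft y≉z (λ e → x≉z (sym e)) (λ e → x≉y (sym e))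
              2y≉s 2z≉s 2x≉s v≉t v+t≉2s q 2q≈s
          by-axes (opposite _ _ (inj₁ x+s≈z+u)) (opposite _ _ (inj₁ y+s≈z+v)) =
            x≢y (from (equal (X ⊕ S) (Z ⊕ U) x+s≈z+u ∸ equal (Y ⊕ S) (Z ⊕ V) y+s≈z+v ⊹ u≐v))
          by-axes (opposite _ _ (inj₂ x+z≈s)) (opposite _ _ (inj₂ y+z≈s)) =
            x≢y (from (equal (X ⊕ Z) S x+z≈s ∸ equal (Y ⊕ Z) S y+z≈s))
          by-axes (opposite u≉t u+t≈2s (inj₁ x+s≈z+u)) (opposite _ _ (inj₂ y+z≈s)) =
            no-interval f∈ fs Wx Wy Wz fu x≉y y≉z x≉z 2x≉s u≉t u+t≈2s x+y≈u x+s≈z+u y+z≈s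
          by-axes (opposite _ _ (inj₂ x+z≈s)) (opposite v≉t v+t≈2s (inj₁ y+s≈z+v)) =
            no-interval f∈ fs Wy Wx Wz fv (λ e → x≉y (sym e)) x≉z y≉z 2y≉s v≉t v+t≈2s
              (trans (comm y x) (trans x+y≈u u≈v)) y+s≈z+v x+z≈s

        -- Once equal and concentric axes are gone, the three are pairwise opposite; but two axes
        -- opposite to a third coincide.
        no-three-moving : ∀ {f s x y z} → Family f → Reflection f s → W x → W y → W z →
          ¬ x ≈ y → ¬ y ≈ z → ¬ x ≈ z → ¬ x + x ≈ s → ¬ y + y ≈ s → ¬ ¬ z + z ≈ s
        no-three-moving {f} {s} {x} {y} {z} f∈ fs Wx Wy Wz x≉y y≉z x≉z 2x≉s 2y≉s 2z≉s =
          by-axes (axes f∈ fs fu fv x≉y 2x≉s 2y≉s) (axes f∈ fs fu ft x≉z 2x≉s 2z≉s)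
            (axes f∈ fs fv ft y≉z 2y≉s 2z≉s)
          where
          flipped : ∀ {w} → W w → ∃ (Reflection (f ⊞ (w ∷ [])))
          flipped Ww = family-reflection (flip f∈ (Ww ∷ []))
          u v t : Carrier
          u = proj₁ (flipped Wx)
          v = proj₁ (flipped Wy)
          t = proj₁ (flipped Wz)
          fu : Reflection (f ⊞ (x ∷ [])) u
          fu = proj₂ (flipped Wx)
          fv : Reflection (f ⊞ (y ∷ [])) v
          fv = proj₂ (flipped Wy)
          ft : Reflection (f ⊞ (z ∷ [])) t
          ft = proj₂ (flipped Wz)
          z≉y : ¬ z ≈ y
          z≉y e = y≉z (sym e)
          y≉x : ¬ y ≈ x
          y≉x e = x≉y (sym e)
          z≉x : ¬ z ≈ x
          z≉x e = x≉z (sym e)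
          open In (s ∷ u ∷ v ∷ t ∷ [])
          S U V T : Term 4
          S = var 0F
          U = var 1F
          V = var 2F
          T = var 3F
          equal : ∀ A B → ⟦ A ⟧ ≈ ⟦ B ⟧ → ⊢ A ≐ B
          equal A B = ⟨_⟩

          by-axes : Axes s x u y v → Axes s x u z t → Axes s y v z t → ⊥
          by-axes (same u≈v x+y≈u) _ _ =
            no-three-same f∈ fs Wx Wy Wz fu fv ft x≉y y≉z x≉z 2x≉s 2y≉s 2z≉s u≈v x+y≈u
          by-axes _ (same u≈t x+z≈u) _ =
            no-three-same f∈ fs Wx Wz Wy fu ft fv x≉z z≉y x≉y 2x≉s 2z≉s 2y≉s u≈t x+z≈u
          by-axes _ _ (same v≈t y+z≈v) =
            no-three-same f∈ fs Wy Wz Wx fv ft fu y≉z z≉x y≉x 2y≉s 2z≉s 2x≉s v≈t y+z≈v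
          by-axes (concentric u≉v u+v≉2s q 2q≈s) _ _ =
            not-concentric f∈ fs Wx Wy Wz fu fv x≉y y≉z x≉z 2x≉s 2y≉s 2z≉s u≉v u+v≉2s q 2q≈s
          by-axes _ (concentric u≉t u+t≉2s q 2q≈s) _ =
            not-concentric f∈ fs Wx Wz Wy fu ft x≉z z≉y x≉y 2x≉s 2z≉s 2y≉s u≉t u+t≉2s q 2q≈s
          by-axes _ _ (concentric v≉t v+t≉2s q 2q≈s) =
            not-concentric f∈ fs Wy Wz Wx fv ft y≉z z≉x y≉x 2y≉s 2z≉s 2x≉s v≉t v+t≉2s q 2q≈s
          by-axes (opposite u≉v _ _) (opposite _ u+t≈2s _) (opposite _ v+t≈2s _) = u≉v (holds
            (from {e′ = U ≐ V} (equal (U ⊕ T) (S ⊕ S) u+t≈2s ∸ equal (V ⊕ T) (S ⊕ S) v+t≈2s)))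

        no-two-fixed : ∀ {f s x y z} → Family f → Reflection f s → W x → W y → W z →
          ¬ x ≈ y → ¬ y ≈ z → ¬ x ≈ z → x + x ≈ s → ¬ y + y ≈ s
        no-two-fixed {f} {s} {x} {y} {z} f∈ fs Wx Wy Wz x≉y y≉z x≉z 2x≈s 2y≈s = by-third ((z + z) ≟ s)
          where
          flipped : ∃ (Reflection (f ⊞ (z ∷ [])))
          flipped = family-reflection (flip f∈ (Wz ∷ []))
          t : Carrier
          t = proj₁ flipped
          by-third : Dec (z + z ≈ s) → ⊥
          by-third (yes 2z≈s) = double-injective (trans 2x≈s (sym 2y≈s)) (trans 2x≈s (sym 2z≈s)) x≉y x≉z y≉z
          by-third (no 2z≉s) = no-three-moving (flip f∈ (Wz ∷ [])) (proj₂ flipped) Wx Wy Wz x≉y y≉z x≉z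
            (λ 2x≈t → t≉s (trans (sym 2x≈t) 2x≈s)) (λ 2y≈t → t≉s (trans (sym 2y≈t) 2y≈s))
            (not-fixed f∈ fs (proj₂ flipped) 2z≉s)
            where
            t≉s : ¬ t ≈ s
            t≉s = axis-moves f∈ fs (proj₂ flipped) 2z≉s

        no-member : ∀ {f} → ¬ Family f
        no-member {f} f∈ = by-fixed ((p₀ + p₀) ≟ s) ((p₁ + p₁) ≟ s) ((p₂ + p₂) ≟ s) ((p₃ + p₃) ≟ s)
          where
          s : Carrier
          s = proj₁ (family-reflection f∈)
          fs : Reflection f s
          fs = proj₂ (family-reflection f∈)
          by-fixed : Dec (p₀ + p₀ ≈ s) → Dec (p₁ + p₁ ≈ s) → Dec (p₂ + p₂ ≈ s) → Dec (p₃ + p₃ ≈ s) → ⊥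
          by-fixed (yes e₀) (yes e₁) _ _ = no-two-fixed f∈ fs W₀ W₁ W₂ p₀≉p₁ p₁≉p₂ p₀≉p₂ e₀ e₁
          by-fixed (yes e₀) _ (yes e₂) _ = no-two-fixed f∈ fs W₀ W₂ W₃ p₀≉p₂ p₂≉p₃ p₀≉p₃ e₀ e₂
          by-fixed (yes e₀) _ _ (yes e₃) =
            no-two-fixed f∈ fs W₀ W₃ W₂ p₀≉p₃ (λ e → p₂≉p₃ (sym e)) p₀≉p₂ e₀ e₃
          by-fixed _ (yes e₁) (yes e₂) _ = no-two-fixed f∈ fs W₁ W₂ W₃ p₁≉p₂ p₂≉p₃ p₁≉p₃ e₁ e₂
          by-fixed _ (no n₁) (no n₂) (no n₃) = no-three-moving f∈ fs W₁ W₂ W₃ p₁≉p₂ p₂≉p₃ p₁≉p₃ n₁ n₂ n₃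
          by-fixed (no n₀) (no n₁) (no n₂) _ = no-three-moving f∈ fs W₀ W₁ W₂ p₀≉p₁ p₁≉p₂ p₀≉p₂ n₀ n₁ n₂
          by-fixed (no n₀) (no n₁) _ (no n₃) = no-three-moving f∈ fs W₀ W₁ W₃ p₀≉p₁ p₁≉p₃ p₀≉p₃ n₀ n₁ n₃
          by-fixed (no n₀) _ (no n₂) (no n₃) = no-three-moving f∈ fs W₀ W₂ W₃ p₀≉p₂ p₂≉p₃ p₀≉p₃ n₀ n₂ n₃
          by-fixed _ (yes e₁) _ (yes e₃) = no-two-fixed f∈ fs W₁ W₃ W₂ p₁≉p₃ (λ e → p₂≉p₃ (sym e)) p₁≉p₂ e₁ e₃
          by-fixed _ _ (yes e₂) (yes e₃) =
            no-two-fixed f∈ fs W₂ W₃ W₁ p₂≉p₃ (λ e → p₁≉p₃ (sym e)) (λ e → p₁≉p₂ (sym e)) e₂ e₃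

-- Torsion in the circle

open import Defs

fromℤ-* : ∀ m n → fromℤ m ℚ.* fromℤ n ≡ fromℤ (m ℤ.* n)
fromℤ-* m n = ℚ.toℚᵘ-injective (ℚᵘ.≃-trans (ℚ.toℚᵘ-homo-* (fromℤ m) (fromℤ n)) (ℚᵘ.*≡* ≡.refl))

fromℤ-*-/ : ∀ i k .{{_ : NonZero k}} → fromℤ (+ k) ℚ.* (i / k) ≡ fromℤ i
fromℤ-*-/ i k@(ℕ.suc k-1) = ℚ.toℚᵘ-injective (ℚᵘ.≃-trans (ℚ.toℚᵘ-homo-* (fromℤ (+ k)) (i / k))
  (ℚᵘ.≃-trans (ℚᵘ.*-congˡ (ℚ.toℚᵘ-fromℚᵘ (ℚᵘ.mkℚᵘ i k-1)))
    (ℚᵘ.*≡* (≡.trans (ℤ.*-identityʳ (+ k ℤ.* i)) (≡.trans (ℤ.*-comm (+ k) i)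
      (≡.cong (i ℤ.*_) (≡.sym (ℤ.*-identityˡ (+ k)))))))))

private
  scaled-remainder : ∀ k x y r q → k ℚ.* (x ℚ.- (y ℚ.+ r) ℚ.- q) ≡
    k ℚ.* (x ℚ.- y) ℚ.- (k ℚ.* r ℚ.+ q ℚ.* k)
  scaled-remainder = solve 5 (λ k x y r q →
    k :* (x :- (y :+ r) :- q) := k :* (x :- y) :- (k :* r :+ q :* k)) ≡.refl
    where open +-*-Solver

  ∣p∣≤∣k*p∣ : ∀ k p .{{_ : NonZero k}} → ∣ p ∣ ℚ.≤ ∣ fromℤ (+ k) ℚ.* p ∣
  ∣p∣≤∣k*p∣ k p = begin
    ∣ p ∣                        ≡⟨ ℚ.*-identityˡ ∣ p ∣ ⟨
    1ℚ ℚ.* ∣ p ∣                 ≤⟨ ℚ.*-monoʳ-≤-nonNeg ∣ p ∣ {{ℚ.∣-∣-nonNeg p}} 1≤k ⟩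
    fromℤ (+ k) ℚ.* ∣ p ∣        ≡⟨ ℚ.∣p*q∣≡∣p∣*∣q∣ (fromℤ (+ k)) p ⟨
    ∣ fromℤ (+ k) ℚ.* p ∣        ∎
    where
    open ℚ.≤-Reasoning
    1≤k : 1ℚ ℚ.≤ fromℤ (+ k)
    1≤k = ℚ.*≤* (ℤ.*-monoʳ-≤-nonNeg (+ 1) (ℤ.+≤+ (ℕ.>-nonZero⁻¹ k)))

-- Dividing `m` by `k` with remainder, the remainder gives the fraction `i / k` and the quotient the
-- integer by which the two sides differ. Since `∣ p ∣ ≤ ∣ k p ∣`, the same `N` works for the same
-- `ε`.
divide : ∀ k .{{_ : NonZero k}} x y m →
  Null (λ n → fromℤ (+ k) ℚ.* (seq x n ℚ.- seq y n) ℚ.- fromℤ m) →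
  ∃[ i ] i ℕ.< k × x ≈ y + fromℚ (+ i / k)
divide k x y m kx-ky→m = i , ℤ.n%ℕd<d m k , q , λ ε 0<ε →
  let N , small = kx-ky→m ε 0<ε in N , λ n N≤n → ℚ.≤-<-trans
    (≡.subst (∣ t n ∣ ℚ.≤_) (≡.cong ∣_∣ (k*t n)) (∣p∣≤∣k*p∣ k (t n))) (small n N≤n)
  where
  i : ℕ
  i = m ℤ.%ℕ k
  q : ℤ
  q = m ℤ./ℕ k
  t : ℕ → ℚ
  t n = seq x n ℚ.- (seq y n ℚ.+ (+ i / k)) ℚ.- fromℤ q
  k*t : ∀ n → fromℤ (+ k) ℚ.* t n ≡ fromℤ (+ k) ℚ.* (seq x n ℚ.- seq y n) ℚ.- fromℤ m
  k*t n = ≡.trans (scaled-remainder (fromℤ (+ k)) (seq x n) (seq y n) (+ i / k) (fromℤ q))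
    (≡.cong (λ p → fromℤ (+ k) ℚ.* (seq x n ℚ.- seq y n) ℚ.- p) (begin
      fromℤ (+ k) ℚ.* (+ i / k) ℚ.+ fromℤ q ℚ.* fromℤ (+ k) ≡⟨ ≡.cong₂ ℚ._+_ (fromℤ-*-/ (+ i) k) (fromℤ-* q (+ k)) ⟩
      fromℤ (+ i) ℚ.+ fromℤ (q ℤ.* + k)                     ≡⟨ fromℤ-+ (+ i) (q ℤ.* + k) ⟩
      fromℤ (+ i ℤ.+ q ℤ.* + k)                             ≡⟨ ≡.cong fromℤ (ℤ.a≡a%ℕn+[a/ℕn]*n m k) ⟨
      fromℤ m                                               ∎))
    where open ≡-Reasoning

module S = AbelianGroup S¹-abelianGroup

module _ (x y : S¹) where

  private
    d : ℕ → ℚ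
    d n = seq x n ℚ.- seq y n

    open +-*-Solver

    Null-resp-≗ : ∀ {s t : ℕ → ℚ} → (∀ n → s n ≡ t n) → Null s → Null t
    Null-resp-≗ s≗t s→0 ε 0<ε = let N , small = s→0 ε 0<ε in
      N , λ n N≤n → ≡.subst (λ p → ∣ p ∣ ℚ.< ε) (s≗t n) (small n N≤n)

  2-torsion : x + x ≈ y + y → ∃[ i ] i ℕ.< 2 × x ≈ y + fromℚ (+ i / 2)
  2-torsion (m , 2x≈2y) = divide 2 x y m (Null-resp-≗ (λ n → regroup (seq x n) (seq y n) (fromℤ m)) 2x≈2y)
    where
    regroup : ∀ x y m → x ℚ.+ x ℚ.- (y ℚ.+ y) ℚ.- m ≡ fromℤ (+ 2) ℚ.* (x ℚ.- y) ℚ.- m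
    regroup = solve 3 (λ x y m → x :+ x :- (y :+ y) :- m := con (fromℤ (+ 2)) :* (x :- y) :- m) ≡.refl

  4-torsion : (x + x) + (x + x) ≈ (y + y) + (y + y) → ∃[ i ] i ℕ.< 4 × x ≈ y + fromℚ (+ i / 4)
  4-torsion (m , 4x≈4y) = divide 4 x y m (Null-resp-≗ (λ n → regroup (seq x n) (seq y n) (fromℤ m)) 4x≈4y)
    where
    regroup : ∀ x y m → (x ℚ.+ x) ℚ.+ (x ℚ.+ x) ℚ.- ((y ℚ.+ y) ℚ.+ (y ℚ.+ y)) ℚ.- m ≡
      fromℤ (+ 4) ℚ.* (x ℚ.- y) ℚ.- m
    regroup = solve 3 (λ x y m → (x :+ x) :+ (x :+ x) :- ((y :+ y) :+ (y :+ y)) :- m :=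
      con (fromℤ (+ 4)) :* (x :- y) :- m) ≡.refl

  5-torsion : (x + x) + (x + x) + x ≈ (y + y) + (y + y) + y → ∃[ i ] i ℕ.< 5 × x ≈ y + fromℚ (+ i / 5)
  5-torsion (m , 5x≈5y) = divide 5 x y m (Null-resp-≗ (λ n → regroup (seq x n) (seq y n) (fromℤ m)) 5x≈5y)
    where
    regroup : ∀ x y m → (x ℚ.+ x) ℚ.+ (x ℚ.+ x) ℚ.+ x ℚ.- ((y ℚ.+ y) ℚ.+ (y ℚ.+ y) ℚ.+ y) ℚ.- m ≡
      fromℤ (+ 5) ℚ.* (x ℚ.- y) ℚ.- m
    regroup = solve 3 (λ x y m → (x :+ x) :+ (x :+ x) :+ x :- ((y :+ y) :+ (y :+ y) :+ y) :- m :=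
      con (fromℤ (+ 5)) :* (x :- y) :- m) ≡.refl

antipode : ∀ {x y} → (∃[ i ] i ℕ.< 2 × x ≈ y + fromℚ (+ i / 2)) → ¬ x ≈ y → x ≈ y + fromℚ ½
antipode {x} {y} (0 , _ , x≈y) x≉y = contradiction (S.trans {x} {y + fromℚ 0ℚ} {y} x≈y (S.identityʳ y)) x≉y
antipode (1 , _ , x≈y+½) _ = x≈y+½
antipode (ℕ.suc (ℕ.suc _) , ℕ.s≤s (ℕ.s≤s ()) , _)

-- Both `y` and `z` would be antipodal to `x`.
S¹-double-injective : ∀ {x y z} → x + x ≈ y + y → x + x ≈ z + z → ¬ x ≈ y → ¬ x ≈ z → ¬ y ≈ z → ⊥
S¹-double-injective {x} {y} {z} 2x≈2y 2x≈2z x≉y x≉z y≉z = y≉z (∙-cancelʳ (fromℚ ½) y z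
  (S.trans {y + fromℚ ½} {x} {z + fromℚ ½}
    (S.sym {x} {y + fromℚ ½} (antipode {x} {y} (2-torsion x y 2x≈2y) x≉y))
    (antipode {x} {z} (2-torsion x z 2x≈2z) x≉z)))
  where open import Algebra.Properties.AbelianGroup S¹-abelianGroup using (∙-cancelʳ)

-- Extensions of a precoloring of the circle

color : Bool → Color
color true = R
color false = B

uncolor : Color → Bool
uncolor R = true
uncolor B = false

color-uncolor : ∀ k → color (uncolor k) ≡ k
color-uncolor R = ≡.refl
color-uncolor B = ≡.refl

color-injective : ∀ {a b} → color a ≡ color b → a ≡ b
color-injective {true} {true} _ = ≡.refl
color-injective {false} {false} _ = ≡.refl

module Extension (em : ExcludedMiddle 0ℓ) (W : Pred S¹ 0ℓ) (W-resp : W Respects _≈_)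
  (four : HasCardinality W 4) (T′W : T′ W) (c : Precoloring W) where

  open Colorings S¹-abelianGroup (λ _ _ → em)

  point : Fin 4 → S¹
  point i = proj₁ (Bijection.to four i)

  W-point : ∀ i → W (point i)
  W-point i = proj₂ (Bijection.to four i)

  distinct : ∀ i j → ¬ i ≡ j → ¬ point i ≈ point j
  distinct i j i≢j e = i≢j (Bijection.injective four e)

  -- The remainders 1 and 3 are excluded by `T′`. The remainder 2 is not coprime to 4, so antipodal
  -- points of `W` are allowed and only the doubles can be equated.
  quarter : ∀ {x y} → W x → W y → (x + x) + (x + x) ≈ (y + y) + (y + y) → x + x ≈ y + y
  quarter {x} {y} Wx Wy 4x≈4y = by-remainder (4-torsion x y 4x≈4y)
    where
    by-remainder : (∃[ i ] i ℕ.< 4 × x ≈ y + fromℚ (+ i / 4)) → x + x ≈ y + y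
    by-remainder (0 , _ , e) = S.∙-cong {x} {y} {x} {y} x≈y x≈y
      where
      x≈y : x ≈ y
      x≈y = S.trans {x} {y + fromℚ 0ℚ} {y} e (S.identityʳ y)
    by-remainder (1 , _ , e) = ⊥-elim (T′W 4 (inj₁ ≡.refl) 1 (ℕ.s≤s ℕ.z≤n) (ℕ.s≤s ℕ.z≤n) ≡.refl x ((y , Wy , e) , Wx))
    by-remainder (2 , _ , e) = S.trans {x + x} {y + fromℚ ½ + (y + fromℚ ½)} {y + y}
      (S.∙-cong {x} {y + fromℚ ½} {x} {y + fromℚ ½} e e)
      (+ 1 , λ ε 0<ε → 0 , λ n _ → ≡.subst (λ p → ∣ p ∣ ℚ.< ε) (≡.sym (full-turn (seq y n))) 0<ε)
      where
      full-turn : ∀ y → (y ℚ.+ ½) ℚ.+ (y ℚ.+ ½) ℚ.- (y ℚ.+ y) ℚ.- fromℤ (+ 1) ≡ 0ℚ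
      full-turn = solve 1 (λ y → (y :+ con ½) :+ (y :+ con ½) :- (y :+ y) :- con (fromℤ (+ 1)) := con 0ℚ) ≡.refl
        where open +-*-Solver
    by-remainder (3 , _ , e) = ⊥-elim (T′W 4 (inj₁ ≡.refl) 3 (ℕ.s≤s ℕ.z≤n) ℕ.≤-refl ≡.refl x ((y , Wy , e) , Wx))
    by-remainder (ℕ.suc (ℕ.suc (ℕ.suc (ℕ.suc _))) , ℕ.s≤s (ℕ.s≤s (ℕ.s≤s (ℕ.s≤s ()))) , _)

  fifth : ∀ {x y} → W x → W y → (x + x) + (x + x) + x ≈ (y + y) + (y + y) + y → x ≈ y
  fifth {x} {y} Wx Wy 5x≈5y = by-remainder (5-torsion x y 5x≈5y)
    where
    by-remainder : (∃[ i ] i ℕ.< 5 × x ≈ y + fromℚ (+ i / 5)) → x ≈ y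
    by-remainder (0 , _ , e) = S.trans {x} {y + fromℚ 0ℚ} {y} e (S.identityʳ y)
    by-remainder (1 , _ , e) = ⊥-elim (T′W 5 (inj₂ ≡.refl) 1 (ℕ.s≤s ℕ.z≤n) (ℕ.s≤s ℕ.z≤n) ≡.refl x ((y , Wy , e) , Wx))
    by-remainder (2 , _ , e) = ⊥-elim (T′W 5 (inj₂ ≡.refl) 2 (ℕ.s≤s ℕ.z≤n) (ℕ.s≤s (ℕ.s≤s ℕ.z≤n)) ≡.refl x ((y , Wy , e) , Wx))
    by-remainder (3 , _ , e) = ⊥-elim (T′W 5 (inj₂ ≡.refl) 3 (ℕ.s≤s ℕ.z≤n) (ℕ.n≤1+n 3) ≡.refl x ((y , Wy , e) , Wx))
    by-remainder (4 , _ , e) = ⊥-elim (T′W 5 (inj₂ ≡.refl) 4 (ℕ.s≤s ℕ.z≤n) ℕ.≤-refl ≡.refl x ((y , Wy , e) , Wx))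
    by-remainder (ℕ.suc (ℕ.suc (ℕ.suc (ℕ.suc (ℕ.suc _)))) , ℕ.s≤s (ℕ.s≤s (ℕ.s≤s (ℕ.s≤s (ℕ.s≤s ())))) , _)

  -- Extensions of `c` as Boolean functions, so that flipping is exclusive or.
  Family : (S¹ → Bool) → Set
  Family f = Respectful f × (∀ p → color (f (proj₁ p)) ≡ c ⟨$⟩ p)

  parity-outside : ∀ {Q t} → All W Q → ¬ W t → parity Q t ≡ false
  parity-outside [] _ = ≡.refl
  parity-outside {x ∷ Q} {t} (Wx ∷ WQ) t∉W =
    ≡.cong₂ _xor_ (δ-≉ {x} {t} λ x≈t → t∉W (W-resp {x} {t} x≈t Wx)) (parity-outside WQ t∉W)

  flip : ∀ {f Q} → Family f → All W Q → Family (f ⊞ Q)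
  flip {f} {Q} (f-resp , f-extends) WQ =
    (λ {s} {t} → ⊞-respectful {f} f-resp Q {s} {t}) ,
    λ { (t , t∉W) → ≡.trans
          (≡.cong color (≡.trans (≡.cong (f t xor_) (parity-outside WQ t∉W)) (xor-identityʳ (f t))))
          (f-extends (t , t∉W)) }

  coloring : ∀ {f} → Family f → Coloring
  coloring {f} (f-resp , _) = record
    { to = λ t → color (f t)
    ; cong = λ {s} {t} s≈t → ≡.cong color (f-resp {s} {t} s≈t)
    }

  Invariant : (S¹ → Bool) → O2 → Set
  Invariant f γ = ∀ x → color (f (γ · x)) ≡ color (f x)

  σ-identity : ∀ a → a ≈ S.ε → IsIdentity (σ a)
  σ-identity a a≈0 x = S.trans {x + a} {x + S.ε} {x}
    (+-cong {x} {x} {a} {S.ε} (S.refl {x}) a≈0) (S.identityʳ x)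

  invariant⇒symmetric : ∀ {f} → Respectful f → ∀ γ → ¬ IsIdentity γ → Invariant f γ →
    ∃ (Reflection f) ⊎ ∃[ a ] ¬ a ≈ S.ε × Rotation f a
  invariant⇒symmetric {f} f-resp (σ a) σ≢1 fixed =
    inj₂ (a , (λ a≈0 → σ≢1 (σ-identity a a≈0)) , λ t → color-injective {f (t + a)} {f t} (fixed t))
  invariant⇒symmetric {f} f-resp (τ a) _ fixed =
    inj₁ (a + a , reflection-by {f} (a + a) (τ a ·_) f-resp reflected
      λ t → color-injective {f (τ a · t)} {f t} (fixed t))
    where
    cancel-all : ∀ a t → (ℚ.- t ℚ.+ (a ℚ.+ a)) ℚ.- ((a ℚ.+ a) ℚ.- t) ℚ.- fromℤ (+ 0) ≡ 0ℚ
    cancel-all = solve 2 (λ a t →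
      (:- t :+ (a :+ a)) :- ((a :+ a) :- t) :- con (fromℤ (+ 0)) := con 0ℚ) ≡.refl
      where open +-*-Solver
    reflected : ∀ t → (τ a · t) S.≈ (a + a) S.- t
    reflected t = + 0 , λ ε 0<ε → 0 , λ n _ →
      ≡.subst (λ q → ∣ q ∣ ℚ.< ε) (≡.sym (cancel-all (seq a n) (seq t n))) 0<ε

  symmetric : ¬ (∃[ d ] Extends W d c × Distinguishing d) → ∀ {f} → Family f →
    ∃ (Reflection f) ⊎ ∃[ a ] ¬ a ≈ S.ε × Rotation f a
  symmetric no-extension {f} f∈ = by-symmetry em
    where
    by-symmetry : Dec (∃[ γ ] ¬ IsIdentity γ × Invariant f γ) →
      ∃ (Reflection f) ⊎ ∃[ a ] ¬ a ≈ S.ε × Rotation f a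
    by-symmetry (yes (γ , γ≢1 , fixed)) = invariant⇒symmetric (proj₁ f∈) γ γ≢1 fixed
    by-symmetry (no none) = contradiction (coloring f∈ , proj₂ f∈ , none) no-extension

  -- The value on `W` is arbitrary: some member of the family is wanted as a start. The decision is
  -- an argument so that `extend-resp` can match on two of them.
  extend : ∀ t → Dec (W t) → Bool
  extend t (yes _) = false
  extend t (no t∉W) = uncolor (c ⟨$⟩ (t , t∉W))

  extend-resp : ∀ {s t} (s? : Dec (W s)) (t? : Dec (W t)) → s ≈ t → extend s s? ≡ extend t t?
  extend-resp (yes _) (yes _) _ = ≡.refl
  extend-resp {s} {t} (yes Ws) (no t∉W) s≈t = contradiction (W-resp {s} {t} s≈t Ws) t∉W
  extend-resp {s} {t} (no s∉W) (yes Wt) s≈t = contradiction (W-resp {t} {s} (S.sym {s} {t} s≈t) Wt) s∉W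
  extend-resp {s} {t} (no s∉W) (no t∉W) s≈t =
    ≡.cong uncolor (Func.cong c {s , s∉W} {t , t∉W} s≈t)

  extend-extends : ∀ p (p? : Dec (W (proj₁ p))) → color (extend (proj₁ p) p?) ≡ c ⟨$⟩ p
  extend-extends (t , t∉W) (yes Wt) = contradiction Wt t∉W
  extend-extends (t , t∉W) (no t∉W′) = ≡.trans (color-uncolor _)
    (Func.cong c {t , t∉W′} {t , t∉W} (S.refl {t}))

  initial : Family (λ t → extend t em)
  initial = (λ {s} {t} → extend-resp {s} {t} em em) , λ p → extend-extends p em

  extension : ∃[ d ] Extends W d c × Distinguishing d
  extension = decidable-stable em λ no-extension →
    Symmetries.no-member S¹-abelianGroup (λ _ _ → em) (λ {x} {y} {z} → S¹-double-injective {x} {y} {z})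
      W (λ {x} {y} → quarter {x} {y}) (λ {x} {y} → fifth {x} {y})
      Family proj₁ flip (symmetric no-extension) (W-point 0F) (W-point 1F) (W-point 2F) (W-point 3F)
      (distinct 0F 1F λ ()) (distinct 0F 2F λ ()) (distinct 0F 3F λ ())
      (distinct 1F 2F λ ()) (distinct 1F 3F λ ()) (distinct 2F 3F λ ())
      initial

theorem2p3p1 : ExcludedMiddle 0ℓ →
    ∀ (W : Pred S¹ 0ℓ) → W Respects _≈_ →
    HasCardinality W 4 →
    T′ W →
    P W
theorem2p3p1 = Extension.extension
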